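{- Let $p\in S_n$ be a pattern avoiding $1324$. If $p$ is $f$-incompatible, then for at least one choice of $q$ among $p,\ p^{ -1},\ p^{\mathrm{rc}},\ (p^{\mathrm{rc}})^{ -1}$, one of the following conditions holds: (a) $\mathrm{comp}(q)\ge 3$. (b) $\mathrm{comp}(q\smallsetminus q_1)>\mathrm{comp}(q)$. (c) $q_1>1$, $\mathrm{comp}(q)=2$, and the first component of $q$ begins with its largest entry. Furthermore, if $q$ is chosen as $p^{\mathrm{rc}}$ or $(p^{\mathrm{rc}})^{ -1}$, then $q_n<n$. (d) $1<q_1<n$ and $q\smallsetminus q_1$ avoids $213$.
   Context: Notation. $\mathrm{Av}(B)$ is the set of permutations avoiding all patterns in $B$ (no subsequence order-isomorphic to a pattern in $B$). For $\pi\in S_n$ and a value $e\in[n]$, $\pi\smallsetminus e$ is the permutation order-isomorphic to the sequence obtained by deleting the entry with value $e$ from $\pi$. The direct sum $\sigma\oplus\tau$ of $\sigma\in S_a,\tau\in S_b$ is $\sigma$ followed by $\tau$ with all values shifted up by $a$. A permutation is decomposable if it is a direct sum of two nonempty permutations, and indecomposable otherwise. Every permutation is uniquely a direct sum of nonempty indecomposable permutations, called its components; $\mathrm{comp}(\pi)$ is their number. $\mathrm{id}_m$ is the identity permutation of length $m$ ($\mathrm{id}_0$ is empty). The reverse-complement of $\pi\in S_n$ is $\pi^{\mathrm{rc}}$ with $\pi^{\mathrm{rc}}_i=n+1-\pi_{n+1-i}$. A permutation $\pi\in S_n$ is almost decomposable if it is indecomposable but $\pi\smallsetminus e$ is decomposable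 for some $e\in\{1,\pi_1,n,\pi_n\}$. The map $f$. Every decomposable $1324$-avoider can be written uniquely as $\pi=\sigma\oplus\mathrm{id}_m\oplus\tau$ with $m\ge0$, $\sigma$ an indecomposable $132$-avoider and $\tau$ an indecomposable $213$-avoider (both nonempty); set $\widetilde f(\pi)=\sigma\oplus\mathrm{id}_{m+1}\oplus\tau$. For a decomposable $1324$-avoider set $f(\pi)=\widetilde f(\pi)$. For an almost decomposable $1324$-avoider $\pi$ define $f(\pi)$ (of length $|\pi|+1$) as follows: (1) if $\pi\smallsetminus\pi_1$ is decomposable, $f(\pi)$ is the permutation with $f(\pi)_1=\pi_1$ and $f(\pi)\smallsetminus\pi_1=\widetilde f(\pi\smallsetminus\pi_1)$; (2) if $\pi\smallsetminus 1$ is decomposable, $f(\pi)=f(\pi^{ -1})^{ -1}$; (3) otherwise (both $\pi\smallsetminus\pi_1$ and $\pi\smallsetminus1$ indecomposable), $f(\pi)=f(\pi^{\mathrm{rc}})^{\mathrm{rc}}$. (For almost decomposable $1324$-avoiders, cases (1) and (2) cannot occur simultaneously.) A pattern $p$ is $f$-compatible if $f(\pi)$ avoids $p$ for every decomposable or almost decomposable permutation $\pi\in\mathrm{Av}(1324,p)$; otherwise it is $f$-incompatible. -}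

module Defs where

open import Data.Bool using (Bool; true; false)
open import Data.Bool.Properties using () renaming (_≟_ to _≟ᵇ_)
open import Data.Empty using (⊥)
open import Data.Fin using (Fin; zero; suc; toℕ; fromℕ; fromℕ<; _<_; _↑ˡ_; _↑ʳ_; join; splitAt)
open import Data.Fin.Patterns using (0F; 1F; 2F)
open import Data.Fin.Permutation as Perm using (Permutation′; permutation; _⟨$⟩ʳ_; _⟨$⟩ˡ_; _≈_; _∘ₚ_; flip; inverseˡ; inverseʳ; remove; reverse; transpose)
open import Data.Fin.Properties using (+↔⊎; splitAt-↑ˡ; splitAt-↑ʳ; join-splitAt; toℕ-↑ˡ; toℕ-↑ʳ; toℕ-injective; toℕ-fromℕ<; all?; any?)
open import Data.List using (List; []; _∷_; _++_; length)
open import Data.List.Relation.Unary.Any using (Any)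
open import Data.Nat using (ℕ; zero; suc; _+_) renaming (_<_ to _<ⁿ_)
open import Data.Nat.Induction using (<-wellFounded)
open import Data.Nat.Properties using (+-assoc; +-comm; m≤m+n; m≤n+m; m<m+n; m<n+m; 0<1+n) renaming (_≟_ to _≟ⁿ_)
open import Data.Product using (∃; ∃₂; _×_; _,_; proj₁; proj₂)
open import Data.Sum using (_⊎_; inj₁; inj₂; [_,_]′)
open import Data.Sum.Function.Propositional using (_⊎-↔_)
open import Function using (_∘_; _⇔_)
open import Function.Construct.Composition using (_↔-∘_)
open import Function.Construct.Symmetry using (↔-sym)
open import Induction.WellFounded using (Acc; acc)
open import Relation.Binary.PropositionalEquality
open import Relation.Nullary using (¬_; Dec; yes; no)
open import Relation.Nullary.Decidable using (map′)

-- A permutation of length n is a bijection π : Permutation′ n of Fin n.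
-- Positions and values are counted from 0, so the first position and the
-- least value are zero, and in Permutation′ (suc n) the last position and the
-- largest value are fromℕ n.  Permutations are compared pointwise (_≈_).

infix 4 _≅_ _,≈_

-- Equality of permutations whose lengths need not be definitionally equal.
record _≅_ {m n} (π : Permutation′ m) (ρ : Permutation′ n) : Set where
  constructor _,≈_
  field
    same-length : m ≡ n
    same-values : subst Permutation′ same-length π ≈ ρ

infix 4 _≼_ _Avoids_

_≼_ : ∀ {k n} → Permutation′ k → Permutation′ n → Set
_≼_ {k} {n} p π = ∃ λ (ι : Fin k → Fin n) →
    (∀ {i j} → i < j → ι i < ι j)
  × (∀ {i j} → (p ⟨$⟩ʳ i < p ⟨$⟩ʳ j) ⇔ (π ⟨$⟩ʳ ι i < π ⟨$⟩ʳ ι j))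

_Avoids_ : ∀ {n k} → Permutation′ n → Permutation′ k → Set
π Avoids p = ¬ (p ≼ π)

pattern-132 : Permutation′ 3
pattern-132 = transpose 1F 2F

pattern-213 : Permutation′ 3
pattern-213 = transpose 0F 1F

pattern-1324 : Permutation′ 4
pattern-1324 = transpose 1F 2F

infixl 8 _∖_

-- remove deletes a position, so deleting the value e removes position π⁻¹(e).
_∖_ : ∀ {n} → Permutation′ (suc n) → Fin (suc n) → Permutation′ n
π ∖ e = remove (π ⟨$⟩ˡ e) π

rc : ∀ {n} → Permutation′ n → Permutation′ n
rc π = reverse ∘ₚ π ∘ₚ reverse

infixr 7 _⊕_

_⊕_ : ∀ {a b} → Permutation′ a → Permutation′ b → Permutation′ (a + b)
σ ⊕ τ = ↔-sym +↔⊎ ↔-∘ ((σ ⊎-↔ τ) ↔-∘ +↔⊎)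

Decomposable : ∀ {n} → Permutation′ n → Set
Decomposable π = ∃₂ λ a b → ∃₂ λ (σ : Permutation′ (suc a)) (τ : Permutation′ (suc b)) →
  π ≅ σ ⊕ τ

Indecomposable : ∀ {n} → Permutation′ n → Set
Indecomposable π = ¬ Decomposable π

AlmostDecomposable : ∀ {n} → Permutation′ n → Set
AlmostDecomposable {zero}  π = ⊥
AlmostDecomposable {suc n} π = Indecomposable π ×
  Any (λ e → Decomposable (π ∖ e))
      (zero ∷ (π ⟨$⟩ʳ zero) ∷ fromℕ n ∷ (π ⟨$⟩ʳ fromℕ n) ∷ [])

infix 4 f̃[_]≡_ f[_]≡_

-- The graph of f̃.  A decomposable 1324-avoider π has exactly one decomposition
-- of the form below, so there is exactly one such ρ up to _≈_.
f̃[_]≡_ : ∀ {n} → Permutation′ n → Permutation′ (suc n) → Set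
f̃[ π ]≡ ρ = ∃ λ a → ∃₂ λ m b →
  ∃₂ λ (σ : Permutation′ (suc a)) (τ : Permutation′ (suc b)) →
      Indecomposable σ × σ Avoids pattern-132
    × Indecomposable τ × τ Avoids pattern-213
    × π ≅ σ ⊕ Perm.id {m} ⊕ τ
    × ρ ≅ σ ⊕ Perm.id {suc m} ⊕ τ

-- The graph of f, which is total and single-valued (up to _≈_) on decomposable
-- and almost decomposable 1324-avoiders: a decomposable permutation is not
-- almost decomposable, π ∖ π₁ and π ∖ 1 are not both decomposable, and inverse
-- and reverse-complement reduce case₂ and case₃ to case₁.
-- In case₁ the values of π and ρ live in Fin's of different sizes, hence toℕ.
data f[_]≡_ : ∀ {n} → Permutation′ n → Permutation′ (suc n) → Set where
  decomposable : ∀ {n} {π : Permutation′ n} {ρ} →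
    f̃[ π ]≡ ρ →
    f[ π ]≡ ρ
  case₁ : ∀ {n} {π : Permutation′ (suc n)} {ρ} →
    AlmostDecomposable π →
    Decomposable (π ∖ (π ⟨$⟩ʳ zero)) →
    toℕ (ρ ⟨$⟩ʳ zero) ≡ toℕ (π ⟨$⟩ʳ zero) →
    f̃[ π ∖ (π ⟨$⟩ʳ zero) ]≡ (ρ ∖ (ρ ⟨$⟩ʳ zero)) →
    f[ π ]≡ ρ
  case₂ : ∀ {n} {π : Permutation′ (suc n)} {ρ} →
    AlmostDecomposable π →
    Decomposable (π ∖ zero) →
    f[ flip π ]≡ flip ρ →
    f[ π ]≡ ρ
  case₃ : ∀ {n} {π : Permutation′ (suc n)} {ρ} →
    AlmostDecomposable π →
    Indecomposable (π ∖ (π ⟨$⟩ʳ zero)) →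
    Indecomposable (π ∖ zero) →
    f[ rc π ]≡ rc ρ →
    f[ π ]≡ ρ

f-Compatible : ∀ {k} → Permutation′ k → Set
f-Compatible p = ∀ {n} (π : Permutation′ n) →
  Decomposable π ⊎ AlmostDecomposable π →
  π Avoids pattern-1324 → π Avoids p →
  ∀ ρ → f[ π ]≡ ρ → ρ Avoids p

f-Incompatible : ∀ {k} → Permutation′ k → Set
f-Incompatible p = ¬ f-Compatible p

data Symmetry : Set where
  self inverse revcomp revcomp-inverse : Symmetry

image : ∀ {n} → Symmetry → Permutation′ n → Permutation′ n
image self            p = p
image inverse         p = flip p
image revcomp         p = rc p
image revcomp-inverse p = flip (rc p)

record Component : Set where
  constructor component
  field
    {size-1}       : ℕ
    perm           : Permutation′ (suc size-1)
    indecomposable : Indecomposable perm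

totalLength : List Component → ℕ
totalLength []                       = 0
totalLength (component {s} _ _ ∷ cs) = suc s + totalLength cs

⨁ : (cs : List Component) → Permutation′ (totalLength cs)
⨁ []                   = Perm.id
⨁ (component σ _ ∷ cs) = σ ⊕ ⨁ cs

≅-refl : ∀ {n} {π : Permutation′ n} → π ≅ π
≅-refl = refl ,≈ λ _ → refl

≅-trans : ∀ {m n o} {π : Permutation′ m} {ρ : Permutation′ n} {υ : Permutation′ o} →
          π ≅ ρ → ρ ≅ υ → π ≅ υ
≅-trans (refl ,≈ p) (refl ,≈ q) = refl ,≈ λ i → trans (p i) (q i)

≅-fromℕ : ∀ {m n} {π : Permutation′ m} {ρ : Permutation′ n} → m ≡ n →
          (∀ i j → toℕ i ≡ toℕ j → toℕ (π ⟨$⟩ʳ i) ≡ toℕ (ρ ⟨$⟩ʳ j)) → π ≅ ρ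
≅-fromℕ refl h = refl ,≈ λ i → toℕ-injective (h i i refl)

⊕-ˡ : ∀ {a b} (σ : Permutation′ a) (τ : Permutation′ b) i →
      (σ ⊕ τ) ⟨$⟩ʳ (i ↑ˡ b) ≡ (σ ⟨$⟩ʳ i) ↑ˡ b
⊕-ˡ {a} {b} σ τ i rewrite splitAt-↑ˡ a i b = refl

⊕-ʳ : ∀ {a b} (σ : Permutation′ a) (τ : Permutation′ b) j →
      (σ ⊕ τ) ⟨$⟩ʳ (a ↑ʳ j) ≡ a ↑ʳ (τ ⟨$⟩ʳ j)
⊕-ʳ {a} {b} σ τ j rewrite splitAt-↑ʳ a b j = refl

data Side a b : Fin (a + b) → Set where
  left  : ∀ i → Side a b (i ↑ˡ b)
  right : ∀ j → Side a b (a ↑ʳ j)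

side : ∀ a {b} k → Side a b k
side a {b} k = subst (Side a b) (join-splitAt a b k) (go (splitAt a k))
  where
  go : ∀ x → Side a b (join a b x)
  go (inj₁ i) = left i
  go (inj₂ j) = right j

≈-⊕ : ∀ {a b} {π : Permutation′ (a + b)} {σ : Permutation′ a} {τ : Permutation′ b} →
      (∀ i → π ⟨$⟩ʳ (i ↑ˡ b) ≡ (σ ⟨$⟩ʳ i) ↑ˡ b) →
      (∀ j → π ⟨$⟩ʳ (a ↑ʳ j) ≡ a ↑ʳ (τ ⟨$⟩ʳ j)) → π ≈ σ ⊕ τ
≈-⊕ {a} {b} {π} {σ} {τ} l r k with side a {b} k
... | left i  = trans (l i) (sym (⊕-ˡ σ τ i))
... | right j = trans (r j) (sym (⊕-ʳ σ τ j))

⊕-cong : ∀ {a a′ b b′} {σ : Permutation′ a} {σ′ : Permutation′ a′}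
         {τ : Permutation′ b} {τ′ : Permutation′ b′} →
         σ ≅ σ′ → τ ≅ τ′ → σ ⊕ τ ≅ σ′ ⊕ τ′
⊕-cong {a} {b = b} {σ = σ} {σ′} {τ} {τ′} (refl ,≈ p) (refl ,≈ q) = refl ,≈ ≈-⊕ {π = σ ⊕ τ} {σ′} {τ′}
  (λ i → trans (⊕-ˡ σ τ i) (cong (_↑ˡ b) (p i)))
  (λ j → trans (⊕-ʳ σ τ j) (cong (a ↑ʳ_) (q j)))

↑ˡ-assoc : ∀ {a} (i : Fin a) b c → toℕ (i ↑ˡ b ↑ˡ c) ≡ toℕ (i ↑ˡ (b + c))
↑ˡ-assoc i b c = trans (toℕ-↑ˡ (i ↑ˡ b) c) (trans (toℕ-↑ˡ i b) (sym (toℕ-↑ˡ i (b + c))))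

↑ˡʳ-assoc : ∀ a {b} (i : Fin b) c → toℕ ((a ↑ʳ i) ↑ˡ c) ≡ toℕ (a ↑ʳ (i ↑ˡ c))
↑ˡʳ-assoc a i c = trans (toℕ-↑ˡ (a ↑ʳ i) c) (trans (toℕ-↑ʳ a i)
  (sym (trans (toℕ-↑ʳ a (i ↑ˡ c)) (cong (a +_) (toℕ-↑ˡ i c)))))

↑ʳ-assoc : ∀ a b {c} (i : Fin c) → toℕ ((a + b) ↑ʳ i) ≡ toℕ (a ↑ʳ (b ↑ʳ i))
↑ʳ-assoc a b i = trans (toℕ-↑ʳ (a + b) i) (trans (+-assoc a b (toℕ i))
  (sym (trans (toℕ-↑ʳ a (b ↑ʳ i)) (cong (a +_) (toℕ-↑ʳ b i)))))

⊕-assoc : ∀ {a b c} (σ : Permutation′ a) (τ : Permutation′ b) (υ : Permutation′ c) →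
          (σ ⊕ τ) ⊕ υ ≅ σ ⊕ (τ ⊕ υ)
⊕-assoc {a} {b} {c} σ τ υ = ≅-fromℕ (+-assoc a b c) go
  where
  via : ∀ {k l} l′ → toℕ k ≡ toℕ l′ → toℕ k ≡ toℕ l →
        toℕ (((σ ⊕ τ) ⊕ υ) ⟨$⟩ʳ k) ≡ toℕ ((σ ⊕ (τ ⊕ υ)) ⟨$⟩ʳ l′) →
        toℕ (((σ ⊕ τ) ⊕ υ) ⟨$⟩ʳ k) ≡ toℕ ((σ ⊕ (τ ⊕ υ)) ⟨$⟩ʳ l)
  via l′ e e′ h = trans h (cong (λ l → toℕ ((σ ⊕ (τ ⊕ υ)) ⟨$⟩ʳ l))
                                (toℕ-injective (trans (sym e) e′)))

  go : ∀ k l → toℕ k ≡ toℕ l →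
       toℕ (((σ ⊕ τ) ⊕ υ) ⟨$⟩ʳ k) ≡ toℕ ((σ ⊕ (τ ⊕ υ)) ⟨$⟩ʳ l)
  go k l e with side (a + b) {c} k
  ... | right j = via (a ↑ʳ (b ↑ʳ j)) (↑ʳ-assoc a b j) e (begin
        toℕ (((σ ⊕ τ) ⊕ υ) ⟨$⟩ʳ ((a + b) ↑ʳ j))     ≡⟨ cong toℕ (⊕-ʳ (σ ⊕ τ) υ j) ⟩
        toℕ ((a + b) ↑ʳ (υ ⟨$⟩ʳ j))                 ≡⟨ ↑ʳ-assoc a b _ ⟩
        toℕ (a ↑ʳ (b ↑ʳ (υ ⟨$⟩ʳ j)))                ≡⟨ cong (λ x → toℕ (a ↑ʳ x)) (⊕-ʳ τ υ j) ⟨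
        toℕ (a ↑ʳ ((τ ⊕ υ) ⟨$⟩ʳ (b ↑ʳ j)))          ≡⟨ cong toℕ (⊕-ʳ σ (τ ⊕ υ) _) ⟨
        toℕ ((σ ⊕ (τ ⊕ υ)) ⟨$⟩ʳ (a ↑ʳ (b ↑ʳ j)))    ∎)
    where open ≡-Reasoning
  ... | left i with side a {b} i
  ...   | left j = via (j ↑ˡ (b + c)) (↑ˡ-assoc j b c) e (begin
        toℕ (((σ ⊕ τ) ⊕ υ) ⟨$⟩ʳ (j ↑ˡ b ↑ˡ c))      ≡⟨ cong toℕ (⊕-ˡ (σ ⊕ τ) υ _) ⟩
        toℕ (((σ ⊕ τ) ⟨$⟩ʳ (j ↑ˡ b)) ↑ˡ c)          ≡⟨ cong (λ x → toℕ (x ↑ˡ c)) (⊕-ˡ σ τ j) ⟩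
        toℕ ((σ ⟨$⟩ʳ j) ↑ˡ b ↑ˡ c)                  ≡⟨ ↑ˡ-assoc _ b c ⟩
        toℕ ((σ ⟨$⟩ʳ j) ↑ˡ (b + c))                 ≡⟨ cong toℕ (⊕-ˡ σ (τ ⊕ υ) j) ⟨
        toℕ ((σ ⊕ (τ ⊕ υ)) ⟨$⟩ʳ (j ↑ˡ (b + c)))     ∎)
    where open ≡-Reasoning
  ...   | right j = via (a ↑ʳ (j ↑ˡ c)) (↑ˡʳ-assoc a j c) e (begin
        toℕ (((σ ⊕ τ) ⊕ υ) ⟨$⟩ʳ ((a ↑ʳ j) ↑ˡ c))    ≡⟨ cong toℕ (⊕-ˡ (σ ⊕ τ) υ _) ⟩
        toℕ (((σ ⊕ τ) ⟨$⟩ʳ (a ↑ʳ j)) ↑ˡ c)          ≡⟨ cong (λ x → toℕ (x ↑ˡ c)) (⊕-ʳ σ τ j) ⟩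
        toℕ ((a ↑ʳ (τ ⟨$⟩ʳ j)) ↑ˡ c)                ≡⟨ ↑ˡʳ-assoc a _ c ⟩
        toℕ (a ↑ʳ ((τ ⟨$⟩ʳ j) ↑ˡ c))                ≡⟨ cong (λ x → toℕ (a ↑ʳ x)) (⊕-ˡ τ υ j) ⟨
        toℕ (a ↑ʳ ((τ ⊕ υ) ⟨$⟩ʳ (j ↑ˡ c)))          ≡⟨ cong toℕ (⊕-ʳ σ (τ ⊕ υ) _) ⟨
        toℕ ((σ ⊕ (τ ⊕ υ)) ⟨$⟩ʳ (a ↑ʳ (j ↑ˡ c)))    ∎)
    where open ≡-Reasoning

⊕-identityʳ : ∀ {n} (π : Permutation′ n) → π ≅ π ⊕ Perm.id {0}
⊕-identityʳ {n} π = ≅-fromℕ (+-comm 0 n) go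
  where
  go : ∀ k l → toℕ k ≡ toℕ l → toℕ (π ⟨$⟩ʳ k) ≡ toℕ ((π ⊕ Perm.id {0}) ⟨$⟩ʳ l)
  go k l e with side n {0} l
  ... | left i rewrite toℕ-injective (trans e (toℕ-↑ˡ i 0)) =
    sym (trans (cong toℕ (⊕-ˡ π Perm.id i)) (toℕ-↑ˡ _ 0))

-- π splits as σ ⊕ τ with |σ| = a when it maps the first a positions onto the
-- first a values.
isLeft : ∀ a {b} → Fin (a + b) → Bool
isLeft a k = [ (λ _ → true) , (λ _ → false) ]′ (splitAt a k)

isLeft-ˡ : ∀ a i b → isLeft a (i ↑ˡ b) ≡ true
isLeft-ˡ a i b rewrite splitAt-↑ˡ a i b = refl

isLeft-ʳ : ∀ a {b} j → isLeft a {b} (a ↑ʳ j) ≡ false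
isLeft-ʳ a {b} j rewrite splitAt-↑ʳ a b j = refl

Cut : ∀ a {b} → Permutation′ (a + b) → Set
Cut a π = ∀ k → isLeft a (π ⟨$⟩ʳ k) ≡ isLeft a k

cut-⊕ : ∀ {a b} {π : Permutation′ (a + b)} {σ : Permutation′ a} {τ : Permutation′ b} →
        π ≈ σ ⊕ τ → Cut a π
cut-⊕ {a} {b} {π} {σ} {τ} eq k rewrite eq k with side a {b} k
... | left i  rewrite ⊕-ˡ σ τ i = trans (isLeft-ˡ a _ b) (sym (isLeft-ˡ a i b))
... | right j rewrite ⊕-ʳ σ τ j = trans (isLeft-ʳ a _) (sym (isLeft-ʳ a j))

getˡ : ∀ a {b} (k : Fin (a + b)) → isLeft a k ≡ true → ∃ λ i → k ≡ i ↑ˡ b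
getˡ a {b} k e with side a {b} k
... | left i  = i , refl
... | right j with () ← trans (sym e) (isLeft-ʳ a j)

getʳ : ∀ a {b} (k : Fin (a + b)) → isLeft a k ≡ false → ∃ λ j → k ≡ a ↑ʳ j
getʳ a {b} k e with side a {b} k
... | right j = j , refl
... | left i with () ← trans (sym e) (isLeft-ˡ a i b)

cut⇒⊕ : ∀ {a b} (π : Permutation′ (a + b)) → Cut a π →
        ∃₂ λ (σ : Permutation′ a) (τ : Permutation′ b) → π ≈ σ ⊕ τ
cut⇒⊕ {a} {b} π cut = σ , τ , ≈-⊕ {π = π} {σ} {τ} (λ i → proj₂ (l π cut i)) (λ j → proj₂ (r π cut j))
  where
  open import Data.Fin.Properties using (↑ˡ-injective; ↑ʳ-injective)

  cut⁻¹ : Cut a (flip π)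
  cut⁻¹ k = trans (sym (cut (π ⟨$⟩ˡ k))) (cong (isLeft a) (inverseʳ π))

  l : ∀ (ρ : Permutation′ (a + b)) → Cut a ρ → ∀ i → ∃ λ i′ → ρ ⟨$⟩ʳ (i ↑ˡ b) ≡ i′ ↑ˡ b
  l ρ c i = getˡ a _ (trans (c (i ↑ˡ b)) (isLeft-ˡ a i b))

  r : ∀ (ρ : Permutation′ (a + b)) → Cut a ρ → ∀ j → ∃ λ j′ → ρ ⟨$⟩ʳ (a ↑ʳ j) ≡ a ↑ʳ j′
  r ρ c j = getʳ a _ (trans (c (a ↑ʳ j)) (isLeft-ʳ a j))

  σ : Permutation′ a
  σ = permutation (proj₁ ∘ l π cut) (proj₁ ∘ l (flip π) cut⁻¹)
    (λ i → ↑ˡ-injective b _ _ (trans (sym (proj₂ (l π cut _)))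
             (trans (cong (π ⟨$⟩ʳ_) (sym (proj₂ (l (flip π) cut⁻¹ i)))) (inverseʳ π))))
    (λ i → ↑ˡ-injective b _ _ (trans (sym (proj₂ (l (flip π) cut⁻¹ _)))
             (trans (cong (π ⟨$⟩ˡ_) (sym (proj₂ (l π cut i)))) (inverseˡ π))))

  τ : Permutation′ b
  τ = permutation (proj₁ ∘ r π cut) (proj₁ ∘ r (flip π) cut⁻¹)
    (λ j → ↑ʳ-injective a _ _ (trans (sym (proj₂ (r π cut _)))
             (trans (cong (π ⟨$⟩ʳ_) (sym (proj₂ (r (flip π) cut⁻¹ j)))) (inverseʳ π))))
    (λ j → ↑ʳ-injective a _ _ (trans (sym (proj₂ (r (flip π) cut⁻¹ _)))
             (trans (cong (π ⟨$⟩ˡ_) (sym (proj₂ (r π cut j)))) (inverseˡ π))))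

SplitsAt : ∀ {n} → Permutation′ n → ℕ → ℕ → Set
SplitsAt π a b = ∃₂ λ (σ : Permutation′ (suc a)) (τ : Permutation′ (suc b)) → π ≅ σ ⊕ τ

splitsAt? : ∀ {n} (π : Permutation′ n) a b → Dec (SplitsAt π a b)
splitsAt? {n} π a b with n ≟ⁿ suc a + suc b
... | no n≢ = no λ (_ , _ , (eq ,≈ _)) → n≢ eq
... | yes refl with all? (λ k → isLeft (suc a) (π ⟨$⟩ʳ k) ≟ᵇ isLeft (suc a) k)
...   | yes cut = yes (let σ , τ , eq = cut⇒⊕ {suc a} π cut in σ , τ , (refl ,≈ eq))
...   | no ¬cut = no λ { (σ , τ , (refl ,≈ eq)) → ¬cut (cut-⊕ {suc a} {π = π} {σ} {τ} eq) }

decomposable? : ∀ {n} (π : Permutation′ n) → Dec (Decomposable π)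
decomposable? {n} π = map′ to from
  (any? λ (a : Fin n) → any? λ (b : Fin n) → splitsAt? π (toℕ a) (toℕ b))
  where
  to : (∃ λ (a : Fin n) → ∃ λ (b : Fin n) → SplitsAt π (toℕ a) (toℕ b)) → Decomposable π
  to (a , b , s) = toℕ a , toℕ b , s

  from : Decomposable π → ∃ λ (a : Fin n) → ∃ λ (b : Fin n) → SplitsAt π (toℕ a) (toℕ b)
  from (a , b , σ , τ , (refl ,≈ eq)) =
      fromℕ< a<n , fromℕ< b<n
    , subst₂ (SplitsAt π) (sym (toℕ-fromℕ< a<n)) (sym (toℕ-fromℕ< b<n)) (σ , τ , (refl ,≈ eq))
    where
    a<n : a <ⁿ suc a + suc b
    a<n = m≤m+n (suc a) (suc b)
    b<n : b <ⁿ suc a + suc b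
    b<n = m≤n+m (suc b) (suc a)

⨁-++ : ∀ cs ds → ⨁ cs ⊕ ⨁ ds ≅ ⨁ (cs ++ ds)
⨁-++ [] ds = refl ,≈ λ _ → refl
⨁-++ (component σ _ ∷ cs) ds =
  ≅-trans (⊕-assoc σ (⨁ cs) (⨁ ds))
    (⊕-cong ≅-refl (⨁-++ cs ds))

decompose : ∀ {n} → Acc _<ⁿ_ n → (π : Permutation′ n) → ∃ λ cs → π ≅ ⨁ cs
decompose {zero} _ π = [] , (refl ,≈ λ ())
decompose {suc n} (acc rec) π with decomposable? π
... | no ind = component π ind ∷ [] , ⊕-identityʳ π
... | yes (a , b , σ , τ , (refl ,≈ eq)) =
  let cs , p = decompose (rec (m<m+n (suc a) 0<1+n)) σ
      ds , q = decompose (rec (m<n+m (suc b) 0<1+n)) τ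
  in cs ++ ds , ≅-trans (refl ,≈ eq)
                  (≅-trans (⊕-cong p q) (⨁-++ cs ds))

-- The decomposition into nonempty indecomposables is unique, so neither comp nor
-- FirstComponentBeginsWithLargest depends on how decompose finds it.
components : ∀ {n} → Permutation′ n → List Component
components π = proj₁ (decompose (<-wellFounded _) π)

⨁-components : ∀ {n} (π : Permutation′ n) → π ≅ ⨁ (components π)
⨁-components π = proj₂ (decompose (<-wellFounded _) π)

comp : ∀ {n} → Permutation′ n → ℕ
comp π = length (components π)

FirstBeginsWithLargest : List Component → Set
FirstBeginsWithLargest []                      = ⊥
FirstBeginsWithLargest (component {s} σ _ ∷ _) = σ ⟨$⟩ʳ zero ≡ fromℕ s

FirstComponentBeginsWithLargest : ∀ {n} → Permutation′ n → Set
FirstComponentBeginsWithLargest π = FirstBeginsWithLargest (components π)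

{-# OPTIONS --safe #-}
module Submission where

-- By induction on the derivation of ρ = f(π), inverting and reverse-complementing
-- p along with π, it suffices to treat f̃ and the first case of f.
--
-- If p lies in σ ⊕ id_{m+1} ⊕ τ but not in σ ⊕ id_m ⊕ τ, then p meets all three
-- blocks: otherwise its middle entries could be moved into an unused block.  So
-- p has two proper cuts, which gives (a).  In the first case of f we may assume
-- that p₁ is embedded as ρ₁, so that p ∖ p₁ lies in σ ⊕ id_{m+1} ⊕ τ.  If it lies
-- in τ alone, it avoids 213, and p₁ is not extreme as p would then lie in π: this
-- is (d).  Otherwise the entries of p ∖ p₁ outside τ form an initial cut
-- c ≤ p₁ - 1.  If c < p₁ - 1, then p₁ covers a cut of p ∖ p₁, which is (b); if
-- c = p₁ - 1, then p₁ is the largest entry of the first component of p, which leads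
-- to (a) or (c).
--
-- The clause pₙ < n of (c) can fail only if π (here already reversed) begins with
-- its largest entry; then deleting that entry shows that one of the deletions
-- which the third case of f assumes to be indecomposable is decomposable.

open import Defs
open import Data.Bool using (true; false)
open import Data.Empty using (⊥)
open import Data.Fin using (Fin; zero; suc; toℕ; fromℕ; fromℕ<; inject≤; opposite; punchIn; _<_; _↑ˡ_; _↑ʳ_)
open import Data.Fin.Patterns using (0F; 1F; 2F)
open import Data.Fin.Permutation as Perm using (Permutation′; _⟨$⟩ʳ_; _⟨$⟩ˡ_; _≈_; flip; inverseˡ; inverseʳ; remove; punchIn-permute)
open import Data.Fin.Properties using (toℕ-injective; toℕ<n; toℕ≤pred[n]; toℕ-fromℕ; toℕ-fromℕ<; toℕ-inject≤; fromℕ<-injective; toℕ-↑ˡ; toℕ-↑ʳ; all?; any?; injective⇒≤; opposite-prop; opposite-involutive; punchIn-injective; punchIn-mono-≤; punchIn-cancel-≤; <-cmp) renaming (_≟_ to _≟ᶠ_)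
open import Data.List using ([]; _∷_; length)
open import Data.Nat using (ℕ; zero; suc; _+_; _∸_; _≤_; _≥_; z≤n; s≤s; s≤s⁻¹; s<s⁻¹; _<?_) renaming (_<_ to _<ⁿ_; _>_ to _>ⁿ_)
open import Data.Nat.Properties hiding (<-cmp)
open import Data.Product using (∃; ∃₂; _×_; _,_; proj₁; proj₂)
open import Data.Sum using (_⊎_; inj₁; inj₂; [_,_]′)
open import Data.Unit using (⊤; tt)
open import Function using (_∘_; id; mk⇔; Equivalence)
open import Relation.Binary.Definitions using (tri<; tri≈; tri>)
open import Relation.Binary.PropositionalEquality
open import Relation.Nullary using (¬_; Dec; yes; no; contradiction)
open import Relation.Nullary.Decidable using (_×-dec_; _→-dec_; _⊎-dec_; ¬?; map′; decidable-stable; toSum)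

-- Pattern containment

⟨$⟩ʳ-injective : ∀ {n} (π : Permutation′ n) {i j} → π ⟨$⟩ʳ i ≡ π ⟨$⟩ʳ j → i ≡ j
⟨$⟩ʳ-injective π eq = trans (sym (inverseˡ π)) (trans (cong (π ⟨$⟩ˡ_) eq) (inverseˡ π))

-- Order reflection comes for free: the values of p are totally ordered, equal values force equal
-- positions, and a reversed pair would contradict order preservation.
mk≼ : ∀ {k n} {p : Permutation′ k} {π : Permutation′ n} (ι : Fin k → Fin n) →
      (∀ {i j} → i < j → ι i < ι j) →
      (∀ {i j} → p ⟨$⟩ʳ i < p ⟨$⟩ʳ j → π ⟨$⟩ʳ ι i < π ⟨$⟩ʳ ι j) → p ≼ π
mk≼ {p = p} {π} ι mono mono′ = ι , mono , mk⇔ mono′ back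
  where
  back : ∀ {i j} → π ⟨$⟩ʳ ι i < π ⟨$⟩ʳ ι j → p ⟨$⟩ʳ i < p ⟨$⟩ʳ j
  back {i} {j} lt with <-cmp (p ⟨$⟩ʳ i) (p ⟨$⟩ʳ j)
  ... | tri< l _ _ = l
  ... | tri≈ _ e _ = contradiction lt (<-irrefl (cong (λ i → toℕ (π ⟨$⟩ʳ ι i)) (⟨$⟩ʳ-injective p e)))
  ... | tri> _ _ g = contradiction lt (<-asym (mono′ g))

≼-mono : ∀ {k n} {p : Permutation′ k} {π : Permutation′ n} (em : p ≼ π) {i j} →
         i < j → proj₁ em i < proj₁ em j
≼-mono (_ , mono , _) = mono

≼-order : ∀ {k n} {p : Permutation′ k} {π : Permutation′ n} (em : p ≼ π) {i j} →
          p ⟨$⟩ʳ i < p ⟨$⟩ʳ j → π ⟨$⟩ʳ proj₁ em i < π ⟨$⟩ʳ proj₁ em j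
≼-order (_ , _ , iff) = Equivalence.to iff

≼-resp-≈ : ∀ {k n} {p p′ : Permutation′ k} {π π′ : Permutation′ n} →
           p ≈ p′ → π ≈ π′ → p ≼ π → p′ ≼ π′
≼-resp-≈ {p = p} {p′} {π} {π′} eq eq′ em@(ι , mono , _) = mk≼ {p = p′} {π′} ι mono
  (λ {i} {j} lt → subst₂ _<_ (eq′ (ι i)) (eq′ (ι j))
    (≼-order {p = p} {π} em (subst₂ _<_ (sym (eq i)) (sym (eq j)) lt)))

≼-trans : ∀ {k m n} {p : Permutation′ k} {π : Permutation′ m} {ρ : Permutation′ n} →
          p ≼ π → π ≼ ρ → p ≼ ρ
≼-trans {p = p} {π} {ρ} e@(ι , _ , _) f@(κ , _ , _) = mk≼ {p = p} {ρ} (κ ∘ ι)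
  (≼-mono {p = π} {ρ} f ∘ ≼-mono {p = p} {π} e)
  (≼-order {p = π} {ρ} f ∘ ≼-order {p = p} {π} e)

-- Inversion exchanges positions and values, so the embedding of the inverses is the map that ι
-- induces on values, and its two monotonicity conditions are those of ι interchanged.
flip-≼ : ∀ {k n} {p : Permutation′ k} {π : Permutation′ n} → p ≼ π → flip p ≼ flip π
flip-≼ {p = p} {π} em@(ι , mono , _) = mk≼ {p = flip p} {flip π}
  (λ x → π ⟨$⟩ʳ ι (p ⟨$⟩ˡ x))
  (λ lt → ≼-order {p = p} {π} em (subst₂ _<_ (sym (inverseʳ p)) (sym (inverseʳ p)) lt))
  (λ lt → subst₂ _<_ (sym (inverseˡ π)) (sym (inverseˡ π)) (mono lt))

opposite-< : ∀ {n} {i j : Fin n} → i < j → opposite j < opposite i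
opposite-< {n} {i} {j} lt rewrite opposite-prop i | opposite-prop j = ∸-monoʳ-< (s≤s lt) (toℕ<n j)

opposite-<⁻¹ : ∀ {n} {i j : Fin n} → opposite i < opposite j → j < i
opposite-<⁻¹ {n} {i} {j} lt =
  subst₂ _<_ (opposite-involutive j) (opposite-involutive i) (opposite-< {i = opposite i} {opposite j} lt)

rc-≼ : ∀ {k n} {p : Permutation′ k} {π : Permutation′ n} → p ≼ π → rc p ≼ rc π
rc-≼ {p = p} {π} em@(ι , mono , _) = mk≼ {p = rc p} {rc π}
  (λ i → opposite (ι (opposite i)))
  (λ {i} {j} lt → opposite-< {i = ι (opposite j)} (mono (opposite-< {i = i} lt)))
  (λ {i} {j} lt →
    subst₂ (λ x y → opposite (π ⟨$⟩ʳ x) < opposite (π ⟨$⟩ʳ y))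
      (sym (opposite-involutive _)) (sym (opposite-involutive _))
      (opposite-< {i = π ⟨$⟩ʳ ι (opposite j)}
        (≼-order {p = p} {π} em (opposite-<⁻¹ {i = p ⟨$⟩ʳ opposite i} lt))))

rc-involutive : ∀ {n} (π : Permutation′ n) → rc (rc π) ≈ π
rc-involutive π i = trans (opposite-involutive _) (cong (π ⟨$⟩ʳ_) (opposite-involutive i))

rc-≼⁻¹ : ∀ {k n} {p : Permutation′ k} {π : Permutation′ n} → rc p ≼ rc π → p ≼ π
rc-≼⁻¹ {p = p} {π} em = ≼-resp-≈ {p = rc (rc p)} {p} {rc (rc π)} {π}
  (rc-involutive p) (rc-involutive π) (rc-≼ {p = rc p} {rc π} em)

-- Quantifying over three positions instead of a map out of `Fin 3` makes avoidance decidable by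
-- finite search.
Occurs213 : ∀ {n} → Permutation′ n → Set
Occurs213 π = ∃ λ i → ∃ λ j → ∃ λ k →
  i < j × j < k × π ⟨$⟩ʳ j < π ⟨$⟩ʳ i × π ⟨$⟩ʳ i < π ⟨$⟩ʳ k

occurs213⇒≼ : ∀ {n} {π : Permutation′ n} → Occurs213 π → pattern-213 ≼ π
occurs213⇒≼ {n} {π} (i , j , k , i<j , j<k , πj<πi , πi<πk) =
  mk≼ {p = pattern-213} {π} ι (λ {x} {y} → mono x y) (λ {x} {y} → order x y)
  where
  ι : Fin 3 → Fin n
  ι 0F = i
  ι 1F = j
  ι 2F = k

  mono : ∀ x y → x < y → ι x < ι y
  mono 0F 1F _ = i<j
  mono 0F 2F _ = <-trans i<j j<k
  mono 1F 2F _ = j<k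
  mono 1F 1F (s≤s ())
  mono 2F 1F (s≤s ())
  mono 2F 2F (s≤s (s≤s ()))

  order : ∀ x y → pattern-213 ⟨$⟩ʳ x < pattern-213 ⟨$⟩ʳ y → π ⟨$⟩ʳ ι x < π ⟨$⟩ʳ ι y
  order 0F 2F _ = πi<πk
  order 1F 0F _ = πj<πi
  order 1F 2F _ = <-trans πj<πi πi<πk
  order 0F 0F (s≤s ())
  order 2F 0F (s≤s ())
  order 2F 2F (s≤s (s≤s ()))

≼⇒occurs213 : ∀ {n} {π : Permutation′ n} → pattern-213 ≼ π → Occurs213 π
≼⇒occurs213 {π = π} em@(ι , mono , _) =
  ι 0F , ι 1F , ι 2F , mono (s≤s z≤n) , mono (s≤s (s≤s z≤n)) ,
  ≼-order {p = pattern-213} {π} em {1F} {0F} (s≤s z≤n) ,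
  ≼-order {p = pattern-213} {π} em {0F} {2F} (s≤s (s≤s z≤n))

avoids213? : ∀ {n} (π : Permutation′ n) → Dec (π Avoids pattern-213)
avoids213? π = ¬? (map′ (occurs213⇒≼ {π = π}) (≼⇒occurs213 {π = π})
  (any? λ i → any? λ j → any? λ k →
    (toℕ i <? toℕ j) ×-dec (toℕ j <? toℕ k)
    ×-dec (toℕ (π ⟨$⟩ʳ j) <? toℕ (π ⟨$⟩ʳ i)) ×-dec (toℕ (π ⟨$⟩ʳ i) <? toℕ (π ⟨$⟩ʳ k))))

-- Cuts

-- Unlike `Cut`, this leaves the length free, so that several cuts of one permutation can be
-- compared. The numbers 0 and n are always cuts; those strictly between them, the proper ones,
-- witness decomposability.
CutAt : ∀ {n} → Permutation′ n → ℕ → Set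
CutAt π k = ∀ i → (toℕ i <ⁿ k → toℕ (π ⟨$⟩ʳ i) <ⁿ k) × (toℕ (π ⟨$⟩ʳ i) <ⁿ k → toℕ i <ⁿ k)

cutAt? : ∀ {n} (π : Permutation′ n) k → Dec (CutAt π k)
cutAt? π k = all? λ i → ((toℕ i <? k) →-dec (toℕ (π ⟨$⟩ʳ i) <? k))
                  ×-dec ((toℕ (π ⟨$⟩ʳ i) <? k) →-dec (toℕ i <? k))

cutAt-length : ∀ {n} (π : Permutation′ n) → CutAt π n
cutAt-length π i = (λ _ → toℕ<n _) , (λ _ → toℕ<n i)

cutAt-resp-≈ : ∀ {n} {π ρ : Permutation′ n} {k} → π ≈ ρ → CutAt π k → CutAt ρ k
cutAt-resp-≈ {k = k} eq cut i = subst (λ x → (toℕ i <ⁿ k → toℕ x <ⁿ k) × (toℕ x <ⁿ k → toℕ i <ⁿ k)) (eq i) (cut i)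

cutAt-resp-≅ : ∀ {m n} {π : Permutation′ m} {ρ : Permutation′ n} {k} → π ≅ ρ → CutAt ρ k → CutAt π k
cutAt-resp-≅ {π = π} {ρ} (refl ,≈ eq) = cutAt-resp-≈ {π = ρ} {π} (sym ∘ eq)

cutAt-flip : ∀ {n} {π : Permutation′ n} {k} → CutAt π k → CutAt (flip π) k
cutAt-flip {π = π} {k} cut x with cut (π ⟨$⟩ˡ x)
... | f , g rewrite inverseʳ π {x} = g , f

m≤o∸n⇒n≤o∸m : ∀ {m n o} → n ≤ o → m ≤ o ∸ n → n ≤ o ∸ m
m≤o∸n⇒n≤o∸m {m} {n} {o} n≤o m≤ = m+n≤o⇒m≤o∸n n
  (subst (_≤ o) (+-comm m n) (m≤o∸n⇒m+n≤o m n≤o m≤))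

-- `opposite` exchanges the numbers below n ∸ k with those from k on, so each half of the new cut is
-- the contrapositive of a half of the old one.
cutAt-rc : ∀ {n} {π : Permutation′ n} {k} → k ≤ n → CutAt π k → CutAt (rc π) (n ∸ k)
cutAt-rc {n} {π} {k} k≤n cut i = to , from
  where
  low⇒high : ∀ (x : Fin n) → toℕ x <ⁿ n ∸ k → k ≤ toℕ (opposite x)
  low⇒high x lt rewrite opposite-prop x = m≤o∸n⇒n≤o∸m k≤n lt

  high⇒low : ∀ (x : Fin n) → k ≤ toℕ x → toℕ (opposite x) <ⁿ n ∸ k
  high⇒low x le = m≤o∸n⇒n≤o∸m (toℕ<n (opposite x))
    (subst (k ≤_) (trans (cong toℕ (sym (opposite-involutive x))) (opposite-prop (opposite x))) le)

  to : toℕ i <ⁿ n ∸ k → toℕ (rc π ⟨$⟩ʳ i) <ⁿ n ∸ k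
  to lt = high⇒low _ (≮⇒≥ λ lt′ → <⇒≱ (proj₂ (cut _) lt′) (low⇒high i lt))

  from : toℕ (rc π ⟨$⟩ʳ i) <ⁿ n ∸ k → toℕ i <ⁿ n ∸ k
  from lt = subst (λ x → toℕ x <ⁿ n ∸ k) (opposite-involutive i) (high⇒low (opposite i)
    (≮⇒≥ λ lt′ → <⇒≱ (proj₁ (cut _) lt′)
      (subst (λ x → k ≤ toℕ x) (opposite-involutive _) (low⇒high _ lt))))

cutAt-⊕ : ∀ {a b} (σ : Permutation′ a) (τ : Permutation′ b) {k} → CutAt τ k → CutAt (σ ⊕ τ) (a + k)
cutAt-⊕ {a} {b} σ τ {k} cut x with side a {b} x
... | left i rewrite ⊕-ˡ σ τ i | toℕ-↑ˡ i b | toℕ-↑ˡ (σ ⟨$⟩ʳ i) b =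
  (λ _ → <-≤-trans (toℕ<n (σ ⟨$⟩ʳ i)) (m≤m+n a k)) , (λ _ → <-≤-trans (toℕ<n i) (m≤m+n a k))
... | right j rewrite ⊕-ʳ σ τ j | toℕ-↑ʳ a j | toℕ-↑ʳ a (τ ⟨$⟩ʳ j) =
  (λ lt → +-monoʳ-< a (proj₁ (cut j) (+-cancelˡ-< a _ _ lt))) ,
  (λ lt → +-monoʳ-< a (proj₂ (cut j) (+-cancelˡ-< a _ _ lt)))

cutAt-⊕ʳ : ∀ {a b} (σ : Permutation′ a) (τ : Permutation′ b) {k} → CutAt (σ ⊕ τ) (a + k) → CutAt τ k
cutAt-⊕ʳ {a} {b} σ τ {k} cut j with cut (a ↑ʳ j)
... | f , g rewrite ⊕-ʳ σ τ j | toℕ-↑ʳ a j | toℕ-↑ʳ a (τ ⟨$⟩ʳ j) =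
  (λ lt → +-cancelˡ-< a _ _ (f (+-monoʳ-< a lt))) , (λ lt → +-cancelˡ-< a _ _ (g (+-monoʳ-< a lt)))

cutAt-⊕ˡ : ∀ {a b} (σ : Permutation′ a) (τ : Permutation′ b) {k} → CutAt (σ ⊕ τ) k → CutAt σ k
cutAt-⊕ˡ {a} {b} σ τ {k} cut i with cut (i ↑ˡ b)
... | f , g rewrite ⊕-ˡ σ τ i | toℕ-↑ˡ i b | toℕ-↑ˡ (σ ⟨$⟩ʳ i) b = f , g

cutAt-zero : ∀ {n} (π : Permutation′ n) → CutAt π 0
cutAt-zero π i = (λ ()) , (λ ())

cutAt-middle : ∀ {a b} (σ : Permutation′ a) (τ : Permutation′ b) → CutAt (σ ⊕ τ) a
cutAt-middle {a} σ τ = subst (CutAt (σ ⊕ τ)) (+-identityʳ a) (cutAt-⊕ σ τ (cutAt-zero τ))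

decomposable⇒cut : ∀ {n} {π : Permutation′ n} → Decomposable π → ∃ λ k → 0 <ⁿ k × k <ⁿ n × CutAt π k
decomposable⇒cut {π = π} (a , b , σ , τ , π≅@(refl ,≈ _)) =
  suc a , s≤s z≤n , m<m+n (suc a) (s≤s z≤n) , cutAt-resp-≅ {π = π} {σ ⊕ τ} π≅ (cutAt-middle σ τ)

isLeft⇒< : ∀ a {b} (x : Fin (a + b)) → isLeft a x ≡ true → toℕ x <ⁿ a
isLeft⇒< a {b} x eq with getˡ a x eq
... | i , refl rewrite toℕ-↑ˡ i b = toℕ<n i

<⇒isLeft : ∀ a {b} (x : Fin (a + b)) → toℕ x <ⁿ a → isLeft a x ≡ true
<⇒isLeft a {b} x lt with side a {b} x
... | left i  = isLeft-ˡ a i b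
... | right j rewrite toℕ-↑ʳ a j = contradiction lt (m+n≮m a (toℕ j))

cutAt⇒Cut : ∀ {a b} {π : Permutation′ (a + b)} → CutAt π a → Cut a π
cutAt⇒Cut {a} {π = π} cut x with isLeft a x in eq | isLeft a (π ⟨$⟩ʳ x) in eq′
... | true  | true  = refl
... | false | false = refl
... | true  | false with () ← trans (sym eq′) (<⇒isLeft a _ (proj₁ (cut x) (isLeft⇒< a x eq)))
... | false | true  with () ← trans (sym eq) (<⇒isLeft a x (proj₂ (cut x) (isLeft⇒< a _ eq′)))

cut⇒decomposable : ∀ {n} {π : Permutation′ n} {k} → 0 <ⁿ k → k <ⁿ n → CutAt π k → Decomposable π
cut⇒decomposable {k = suc a} _ k<n cut with m≤n⇒∃[o]m+o≡n k<n
... | b , refl = go b cut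
  where
  go : ∀ b {π : Permutation′ (suc (suc a + b))} → CutAt π (suc a) → Decomposable π
  go b {π} cut = a , b , split (+-suc (suc a) b) cut
    where
    -- The length is a variable here so that the equation can be matched: `suc (suc a + b)` and
    -- `suc a + suc b` do not agree definitionally.
    split : ∀ {n c} {π : Permutation′ n} → suc a + c ≡ n → CutAt π (suc a) →
            ∃₂ λ (σ : Permutation′ (suc a)) (τ : Permutation′ c) → π ≅ σ ⊕ τ
    split {π = π} refl cut =
      let σ , τ , eq = cut⇒⊕ {suc a} π (cutAt⇒Cut {suc a} {π = π} cut) in σ , τ , (refl ,≈ eq)

decomposable-resp-≈ : ∀ {n} {π ρ : Permutation′ n} → π ≈ ρ → Decomposable π → Decomposable ρ
decomposable-resp-≈ {π = π} {ρ} eq d with decomposable⇒cut {π = π} d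
... | k , 0<k , k<n , cut = cut⇒decomposable {π = ρ} 0<k k<n (cutAt-resp-≈ {π = π} {ρ} eq cut)

decomposable-flip : ∀ {n} {π : Permutation′ n} → Decomposable π → Decomposable (flip π)
decomposable-flip {π = π} d with decomposable⇒cut {π = π} d
... | k , 0<k , k<n , cut = cut⇒decomposable {π = flip π} 0<k k<n (cutAt-flip {π = π} cut)

decomposable-rc : ∀ {n} {π : Permutation′ n} → Decomposable π → Decomposable (rc π)
decomposable-rc {n} {π} d with decomposable⇒cut {π = π} d
... | suc k , 0<k , k<n , cut = cut⇒decomposable {π = rc π} (m<n⇒0<n∸m k<n)
  (∸-monoʳ-< 0<k (<⇒≤ k<n)) (cutAt-rc {π = π} (<⇒≤ k<n) cut)

-- The number of components is the number of nonzero cuts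

tally : ∀ {P : Set} → Dec P → ℕ
tally (yes _) = 1
tally (no _)  = 0

tally-mono : ∀ {P Q : Set} (p : Dec P) (q : Dec Q) → (P → Q) → tally p ≤ tally q
tally-mono (no _)  _       _ = z≤n
tally-mono (yes p) (yes _) _ = ≤-refl
tally-mono (yes p) (no ¬q) f = contradiction (f p) ¬q

tally-yes : ∀ {P : Set} (p : Dec P) → P → tally p ≡ 1
tally-yes (yes _) _ = refl
tally-yes (no ¬p) p = contradiction p ¬p

tally-no : ∀ {P : Set} (p : Dec P) → ¬ P → tally p ≡ 0
tally-no (yes p) ¬p = contradiction p ¬p
tally-no (no _)  _  = refl

count : ∀ {P : ℕ → Set} → (∀ k → Dec (P k)) → ℕ → ℕ
count P? zero    = 0
count P? (suc n) = tally (P? n) + count P? n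

module _ {P : ℕ → Set} (P? : ∀ k → Dec (P k)) where

  count-+ : ∀ a b → count P? (a + b) ≡ count (λ k → P? (a + k)) b + count P? a
  count-+ a zero    = cong (count P?) (+-identityʳ a)
  count-+ a (suc b) = begin
    count P? (a + suc b)                                           ≡⟨ cong (count P?) (+-suc a b) ⟩
    tally (P? (a + b)) + count P? (a + b)                          ≡⟨ cong (tally (P? (a + b)) +_) (count-+ a b) ⟩
    tally (P? (a + b)) + (count (λ k → P? (a + k)) b + count P? a) ≡⟨ +-assoc (tally (P? (a + b))) _ _ ⟨
    tally (P? (a + b)) + count (λ k → P? (a + k)) b + count P? a   ∎
    where open ≡-Reasoning

  count-monoʳ : ∀ {m n} → m ≤ n → count P? m ≤ count P? n
  count-monoʳ {m} m≤n with m≤n⇒∃[o]m+o≡n m≤n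
  ... | o , refl = subst (count P? m ≤_) (sym (count-+ m o)) (m≤n+m (count P? m) _)

  count-hit : ∀ {k n} → P k → k <ⁿ n → count P? k <ⁿ count P? n
  count-hit {k} Pk k<n = ≤-trans (≤-reflexive (cong (_+ count P? k) (sym (tally-yes (P? k) Pk)))) (count-monoʳ k<n)

  count-empty : ∀ n → (∀ {k} → k <ⁿ n → ¬ P k) → count P? n ≡ 0
  count-empty zero    _  = refl
  count-empty (suc n) ¬P = cong₂ _+_ (tally-no (P? n) (¬P ≤-refl)) (count-empty n (¬P ∘ m<n⇒m<1+n))

module _ {P Q : ℕ → Set} (P? : ∀ k → Dec (P k)) (Q? : ∀ k → Dec (Q k)) where

  count-mono : ∀ n → (∀ {k} → k <ⁿ n → P k → Q k) → count P? n ≤ count Q? n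
  count-mono zero    _   = z≤n
  count-mono (suc n) P⇒Q = +-mono-≤ (tally-mono (P? n) (Q? n) (P⇒Q ≤-refl)) (count-mono n (P⇒Q ∘ m<n⇒m<1+n))

  count-mono-< : ∀ n → (∀ {k} → k <ⁿ n → P k → Q k) →
                 ∀ {k} → k <ⁿ n → ¬ P k → Q k → count P? n <ⁿ count Q? n
  count-mono-< (suc n) P⇒Q {k} k<1+n ¬Pk Qk with m≤n⇒m<n∨m≡n (s≤s⁻¹ k<1+n)
  ... | inj₁ k<n  = +-mono-≤-< (tally-mono (P? n) (Q? n) (P⇒Q ≤-refl)) (count-mono-< n (P⇒Q ∘ m<n⇒m<1+n) k<n ¬Pk Qk)
  ... | inj₂ refl rewrite tally-no (P? n) ¬Pk | tally-yes (Q? n) Qk = s≤s (count-mono n (P⇒Q ∘ m<n⇒m<1+n))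

count-cong : ∀ {P Q : ℕ → Set} (P? : ∀ k → Dec (P k)) (Q? : ∀ k → Dec (Q k)) n →
             (∀ k → P k → Q k) → (∀ k → Q k → P k) → count P? n ≡ count Q? n
count-cong P? Q? n f g = ≤-antisym (count-mono P? Q? n λ {k} _ → f k) (count-mono Q? P? n λ {k} _ → g k)

-- The shift makes this range over the cuts at 1, ..., n: 0 is left out and the full length is
-- included, so that each component contributes the cut at its end.
cutCount : ∀ {n} → Permutation′ n → ℕ
cutCount {n} π = count (λ k → cutAt? π (suc k)) n

-- No cut falls strictly inside an indecomposable σ. The first nonzero cut is at its end, and the
-- later ones are the nonzero cuts of τ, shifted.
cutCount-⊕ : ∀ {a b} (σ : Permutation′ (suc a)) (τ : Permutation′ b) → Indecomposable σ →
             cutCount (σ ⊕ τ) ≡ suc (cutCount τ)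
cutCount-⊕ {a} {b} σ τ ind = begin
  cutCount (σ ⊕ τ)                          ≡⟨ count-+ cut? (suc a) b ⟩
  count (cut? ∘ (suc a +_)) b + (tally (cut? a) + count cut? a)
    ≡⟨ cong₂ _+_ shifted (cong₂ _+_ (tally-yes (cut? a) (cutAt-middle σ τ)) (count-empty cut? a inner)) ⟩
  cutCount τ + 1                            ≡⟨ +-comm (cutCount τ) 1 ⟩
  suc (cutCount τ)                          ∎
  where
  open ≡-Reasoning
  cut? : ∀ k → Dec (CutAt (σ ⊕ τ) (suc k))
  cut? k = cutAt? (σ ⊕ τ) (suc k)

  shifted : count (cut? ∘ (suc a +_)) b ≡ cutCount τ
  shifted = count-cong (cut? ∘ (suc a +_)) (λ k → cutAt? τ (suc k)) b
    (λ k → cutAt-⊕ʳ σ τ ∘ subst (CutAt (σ ⊕ τ)) (sym (+-suc (suc a) k)))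
    (λ k → subst (CutAt (σ ⊕ τ)) (+-suc (suc a) k) ∘ cutAt-⊕ σ τ)

  inner : ∀ {k} → k <ⁿ a → ¬ CutAt (σ ⊕ τ) (suc k)
  inner k<a cut = ind (cut⇒decomposable {π = σ} (s≤s z≤n) (s≤s k<a) (cutAt-⊕ˡ σ τ cut))

length≡cutCount : ∀ cs → length cs ≡ cutCount (⨁ cs)
length≡cutCount []                     = refl
length≡cutCount (component σ ind ∷ cs) = trans (cong suc (length≡cutCount cs)) (sym (cutCount-⊕ σ (⨁ cs) ind))

cutCount-cong : ∀ {m n} {π : Permutation′ m} {ρ : Permutation′ n} → π ≅ ρ → cutCount π ≡ cutCount ρ
cutCount-cong {n = n} {π} {ρ} π≅@(refl ,≈ eq) = count-cong _ _ n
  (λ _ → cutAt-resp-≈ {π = π} {ρ} eq) (λ _ → cutAt-resp-≅ {π = π} {ρ} π≅)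

comp≡cutCount : ∀ {n} (π : Permutation′ n) → comp π ≡ cutCount π
comp≡cutCount π = trans (length≡cutCount (components π))
                        (sym (cutCount-cong {π = π} {⨁ (components π)} (⨁-components π)))

-- The full length is a cut as well, so a proper cut makes two nonzero ones.
cut⇒comp≥2 : ∀ {n} {π : Permutation′ n} {k} → 0 <ⁿ k → k <ⁿ n → CutAt π k → comp π ≥ 2
cut⇒comp≥2 {suc n} {π} {suc k} _ k<n cut = subst (2 ≤_) (sym (comp≡cutCount π))
  (≤-trans (s≤s (≤-trans (s≤s z≤n) (count-hit cut? cut (s<s⁻¹ k<n)))) (count-hit cut? {n} (cutAt-length π) ≤-refl))
  where
  cut? : ∀ k → Dec (CutAt π (suc k))
  cut? k = cutAt? π (suc k)

cuts⇒comp≥3 : ∀ {n} {π : Permutation′ n} {k l} → 0 <ⁿ k → k <ⁿ l → l <ⁿ n →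
              CutAt π k → CutAt π l → comp π ≥ 3
cuts⇒comp≥3 {suc n} {π} {suc k} {suc l} _ k<l l<n cut cut′ = subst (3 ≤_) (sym (comp≡cutCount π))
  (≤-trans (s≤s (≤-trans (s≤s (≤-trans (s≤s z≤n) (count-hit cut? cut (s<s⁻¹ k<l))))
                         (count-hit cut? cut′ (s<s⁻¹ l<n))))
           (count-hit cut? {n} (cutAt-length π) ≤-refl))
  where
  cut? : ∀ k → Dec (CutAt π (suc k))
  cut? k = cutAt? π (suc k)

-- The cut just above the first value restricts to the first component. If that component began
-- below its maximum, the restriction would be a proper cut of it.
firstBeginsWithLargest : ∀ {n} {π : Permutation′ (suc n)} cs → π ≅ ⨁ cs →
                         CutAt π (suc (toℕ (π ⟨$⟩ʳ zero))) → FirstBeginsWithLargest cs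
firstBeginsWithLargest [] (() ,≈ _)
firstBeginsWithLargest {π = π} (component {s} σ ind ∷ cs) (refl ,≈ eq) cut
  with m≤n⇒m<n∨m≡n (toℕ≤pred[n] (σ ⟨$⟩ʳ zero))
... | inj₂ e  = toℕ-injective (trans e (sym (toℕ-fromℕ s)))
... | inj₁ lt = contradiction
  (cut⇒decomposable {π = σ} (s≤s z≤n) (s≤s lt)
    (subst (λ x → CutAt σ (suc x)) π₀≡σ₀ (cutAt-⊕ˡ σ (⨁ cs) (cutAt-resp-≈ {π = π} {σ ⊕ ⨁ cs} eq cut))))
  ind
  where
  π₀≡σ₀ : toℕ (π ⟨$⟩ʳ zero) ≡ toℕ (σ ⟨$⟩ʳ zero)
  π₀≡σ₀ = trans (cong toℕ (trans (eq zero) (⊕-ˡ σ (⨁ cs) zero))) (toℕ-↑ˡ (σ ⟨$⟩ʳ zero) _)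

firstComponentBeginsWithLargest : ∀ {n} {π : Permutation′ (suc n)} →
  CutAt π (suc (toℕ (π ⟨$⟩ʳ zero))) → FirstComponentBeginsWithLargest π
firstComponentBeginsWithLargest {π = π} = firstBeginsWithLargest {π = π} (components π) (⨁-components π)

-- Deleting an entry

punchIn-< : ∀ {n} (i : Fin (suc n)) j → toℕ j <ⁿ toℕ i → toℕ (punchIn i j) ≡ toℕ j
punchIn-< (suc i) zero    _        = refl
punchIn-< (suc i) (suc j) (s≤s lt) = cong suc (punchIn-< i j lt)

punchIn-≥ : ∀ {n} (i : Fin (suc n)) j → toℕ i ≤ toℕ j → toℕ (punchIn i j) ≡ suc (toℕ j)
punchIn-≥ zero    _       _        = refl
punchIn-≥ (suc i) (suc j) (s≤s le) = cong suc (punchIn-≥ i j le)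

punchIn-mono-< : ∀ {n} (i : Fin (suc n)) {j k} → j < k → punchIn i j < punchIn i k
punchIn-mono-< i {j} {k} lt = ≰⇒> λ le → <⇒≱ lt (punchIn-cancel-≤ i k j le)

punchIn-cancel-< : ∀ {n} (i : Fin (suc n)) {j k} → punchIn i j < punchIn i k → j < k
punchIn-cancel-< i {j} {k} lt = ≰⇒> λ le → <⇒≱ lt (punchIn-mono-≤ i k j le)

opposite-punchIn : ∀ {n} (i : Fin (suc n)) j →
                   opposite (punchIn i j) ≡ punchIn (opposite i) (opposite j)
opposite-punchIn {n} i j = toℕ-injective (by-cases (<-≤-connex (toℕ j) (toℕ i)))
  where
  open ≡-Reasoning
  by-cases : toℕ j <ⁿ toℕ i ⊎ toℕ i ≤ toℕ j →
             toℕ (opposite (punchIn i j)) ≡ toℕ (punchIn (opposite i) (opposite j))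
  by-cases (inj₁ j<i) = begin
    toℕ (opposite (punchIn i j))              ≡⟨ opposite-prop (punchIn i j) ⟩
    n ∸ toℕ (punchIn i j)                     ≡⟨ cong (n ∸_) (punchIn-< i j j<i) ⟩
    n ∸ toℕ j                                 ≡⟨ +-∸-assoc 1 (toℕ<n j) ⟩
    suc (n ∸ suc (toℕ j))                     ≡⟨ cong suc (opposite-prop j) ⟨
    suc (toℕ (opposite j))                    ≡⟨ punchIn-≥ (opposite i) (opposite j)
                                                   (subst₂ _≤_ (sym (opposite-prop i)) (sym (opposite-prop j)) (∸-monoʳ-≤ n j<i)) ⟨
    toℕ (punchIn (opposite i) (opposite j))   ∎
  by-cases (inj₂ i≤j) = begin
    toℕ (opposite (punchIn i j))              ≡⟨ opposite-prop (punchIn i j) ⟩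
    n ∸ toℕ (punchIn i j)                     ≡⟨ cong (n ∸_) (punchIn-≥ i j i≤j) ⟩
    n ∸ suc (toℕ j)                           ≡⟨ opposite-prop j ⟨
    toℕ (opposite j)                          ≡⟨ punchIn-< (opposite i) (opposite j)
                                                   (subst₂ _<ⁿ_ (sym (opposite-prop j)) (sym (opposite-prop i)) (∸-monoʳ-< (s≤s i≤j) (toℕ<n j))) ⟨
    toℕ (punchIn (opposite i) (opposite j))   ∎

-- `punchIn` is injective, so agreement with π outside position i determines the deletion.
-- Identities between deletions thus become equations about π itself.
remove-unique : ∀ {n} (π : Permutation′ (suc n)) i (ρ : Permutation′ n) →
  (∀ j → punchIn (π ⟨$⟩ʳ i) (ρ ⟨$⟩ʳ j) ≡ π ⟨$⟩ʳ punchIn i j) → ρ ≈ remove i π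
remove-unique π i ρ h j = punchIn-injective (π ⟨$⟩ʳ i) _ _ (trans (h j) (punchIn-permute π i j))

rc-remove : ∀ {n} (π : Permutation′ (suc n)) i → rc (remove (opposite i) π) ≈ remove i (rc π)
rc-remove π i = remove-unique (rc π) i (rc (remove (opposite i) π)) λ j → begin
  punchIn (opposite (π ⟨$⟩ʳ opposite i)) (opposite (remove (opposite i) π ⟨$⟩ʳ opposite j))
    ≡⟨ opposite-punchIn (π ⟨$⟩ʳ opposite i) _ ⟨
  opposite (punchIn (π ⟨$⟩ʳ opposite i) (remove (opposite i) π ⟨$⟩ʳ opposite j))
    ≡⟨ cong opposite (punchIn-permute π (opposite i) (opposite j)) ⟨
  opposite (π ⟨$⟩ʳ punchIn (opposite i) (opposite j))
    ≡⟨ cong (λ x → opposite (π ⟨$⟩ʳ x)) (opposite-punchIn i j) ⟨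
  opposite (π ⟨$⟩ʳ opposite (punchIn i j))
    ∎
  where open ≡-Reasoning

flip-remove : ∀ {n} (π : Permutation′ (suc n)) i → flip (remove i π) ≈ remove (π ⟨$⟩ʳ i) (flip π)
flip-remove π i = remove-unique (flip π) (π ⟨$⟩ʳ i) (flip (remove i π)) λ j → begin
  punchIn (π ⟨$⟩ˡ (π ⟨$⟩ʳ i)) (remove i π ⟨$⟩ˡ j)
    ≡⟨ cong (λ x → punchIn x (remove i π ⟨$⟩ˡ j)) (inverseˡ π) ⟩
  punchIn i (remove i π ⟨$⟩ˡ j)
    ≡⟨ inverseˡ π ⟨
  π ⟨$⟩ˡ (π ⟨$⟩ʳ punchIn i (remove i π ⟨$⟩ˡ j))
    ≡⟨ cong (π ⟨$⟩ˡ_) (punchIn-permute π i _) ⟩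
  π ⟨$⟩ˡ punchIn (π ⟨$⟩ʳ i) (remove i π ⟨$⟩ʳ (remove i π ⟨$⟩ˡ j))
    ≡⟨ cong (λ x → π ⟨$⟩ˡ punchIn (π ⟨$⟩ʳ i) x) (inverseʳ (remove i π)) ⟩
  π ⟨$⟩ˡ punchIn (π ⟨$⟩ʳ i) j
    ∎
  where open ≡-Reasoning

-- Deletion by position avoids the round trip through the inverse contained in `π ∖ (π ⟨$⟩ʳ zero)`.
tail : ∀ {n} → Permutation′ (suc n) → Permutation′ n
tail = remove zero

first : ∀ {n} → Permutation′ (suc n) → ℕ
first π = toℕ (π ⟨$⟩ʳ zero)

∖-first : ∀ {n} (π : Permutation′ (suc n)) → π ∖ (π ⟨$⟩ʳ zero) ≡ tail π
∖-first π = cong (λ i → remove i π) (inverseˡ π)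

module _ {n} (π : Permutation′ (suc n)) where

  tail-suc : ∀ j → π ⟨$⟩ʳ suc j ≡ punchIn (π ⟨$⟩ʳ zero) (tail π ⟨$⟩ʳ j)
  tail-suc = punchIn-permute π zero

  tail-below : ∀ j → toℕ (tail π ⟨$⟩ʳ j) <ⁿ first π → toℕ (π ⟨$⟩ʳ suc j) ≡ toℕ (tail π ⟨$⟩ʳ j)
  tail-below j lt = trans (cong toℕ (tail-suc j)) (punchIn-< _ _ lt)

  tail-above : ∀ j → first π ≤ toℕ (tail π ⟨$⟩ʳ j) → toℕ (π ⟨$⟩ʳ suc j) ≡ suc (toℕ (tail π ⟨$⟩ʳ j))
  tail-above j le = trans (cong toℕ (tail-suc j)) (punchIn-≥ _ _ le)

  tail-mono : ∀ {i j} → tail π ⟨$⟩ʳ i < tail π ⟨$⟩ʳ j → π ⟨$⟩ʳ suc i < π ⟨$⟩ʳ suc j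
  tail-mono {i} {j} lt = subst₂ _<_ (sym (tail-suc i)) (sym (tail-suc j)) (punchIn-mono-< (π ⟨$⟩ʳ zero) lt)

  tail-cancel : ∀ {i j} → π ⟨$⟩ʳ suc i < π ⟨$⟩ʳ suc j → tail π ⟨$⟩ʳ i < tail π ⟨$⟩ʳ j
  tail-cancel {i} {j} lt = punchIn-cancel-< (π ⟨$⟩ʳ zero) (subst₂ _<_ (tail-suc i) (tail-suc j) lt)

  <first⇒tail< : ∀ {j} → toℕ (π ⟨$⟩ʳ suc j) <ⁿ first π → toℕ (tail π ⟨$⟩ʳ j) <ⁿ first π
  <first⇒tail< {j} lt = ≰⇒> λ le → <-asym lt (subst (first π <ⁿ_) (sym (tail-above j le)) (s≤s le))

  first<⇒≤tail : ∀ {j} → first π <ⁿ toℕ (π ⟨$⟩ʳ suc j) → first π ≤ toℕ (tail π ⟨$⟩ʳ j)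
  first<⇒≤tail {j} lt = ≮⇒≥ λ lt′ → <-asym lt (subst (_<ⁿ first π) (sym (tail-below j lt′)) lt′)

  -- The restored entry has both its position and, by the bound on `first π`, its value below k + 1,
  -- so the initial block grows by one on both sides.
  cutAt-suc : ∀ {k} → first π ≤ k → CutAt (tail π) k → CutAt π (suc k)
  cutAt-suc le cut zero    = (λ _ → s≤s le) , (λ _ → s≤s z≤n)
  cutAt-suc {k} le cut (suc j) with <-≤-connex (toℕ (tail π ⟨$⟩ʳ j)) (first π)
  ... | inj₁ lt rewrite tail-below j lt =
    (λ { (s≤s l) → m<n⇒m<1+n (proj₁ (cut j) l) }) , (λ _ → s≤s (proj₂ (cut j) (<-≤-trans lt le)))
  ... | inj₂ ge rewrite tail-above j ge =
    (λ { (s≤s l) → s≤s (proj₁ (cut j) l) }) , (λ { (s≤s l) → s≤s (proj₂ (cut j) l) })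

  cutAt-first≤ : ∀ {k} → CutAt π (suc k) → first π ≤ k
  cutAt-first≤ cut = s≤s⁻¹ (proj₁ (cut zero) (s≤s z≤n))

  cutAt-tail : ∀ {k} → CutAt π (suc k) → CutAt (tail π) k
  cutAt-tail {k} cut j with <-≤-connex (toℕ (tail π ⟨$⟩ʳ j)) (first π) | cut (suc j)
  ... | inj₁ lt | _ , g rewrite tail-below j lt =
    (λ _ → tail<k) , (λ _ → s≤s⁻¹ (g (m<n⇒m<1+n tail<k)))
    where
    tail<k : toℕ (tail π ⟨$⟩ʳ j) <ⁿ k
    tail<k = <-≤-trans lt (cutAt-first≤ cut)
  ... | inj₂ ge | f , g rewrite tail-above j ge = (λ l → s≤s⁻¹ (f (s≤s l))) , (λ l → s≤s⁻¹ (g (s≤s l)))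

  -- Each cut of π beyond 1 moves down by one to a cut of the tail, and 1 is not a cut of π because
  -- π₁ is not its least value. The cut at k is a new one: a cut of π at k + 1 would have to contain
  -- the value π₁.
  comp-tail : ∀ {k} → 0 <ⁿ k → k <ⁿ first π → CutAt (tail π) k → comp (tail π) >ⁿ comp π
  comp-tail {suc k} _ k<first cut = subst₂ _<ⁿ_ (sym comp-π) (sym (comp≡cutCount (tail π)))
    (count-mono-< (cut? ∘ suc) tailCut? n (λ {l} _ → cutAt-tail {suc l}) (<-≤-trans (<-trans (n<1+n k) k<first) (toℕ≤pred[n] (π ⟨$⟩ʳ zero)))
      (λ c → <⇒≱ k<first (cutAt-first≤ c)) cut)
    where
    cut? : ∀ l → Dec (CutAt π (suc l))
    cut? l = cutAt? π (suc l)

    tailCut? : ∀ l → Dec (CutAt (tail π) (suc l))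
    tailCut? l = cutAt? (tail π) (suc l)

    comp-π : comp π ≡ count (cut? ∘ suc) n
    comp-π = trans (comp≡cutCount π) (trans (count-+ cut? 1 n)
      (trans (cong (λ x → count (cut? ∘ suc) n + (x + 0))
               (tally-no (cut? 0) (λ c → <⇒≱ (≤-trans (s≤s z≤n) k<first) (cutAt-first≤ c))))
             (+-identityʳ _)))

-- Closed sets of entries

initialSegment : ∀ {k} {L : Fin k → Set} → (∀ i → Dec (L i)) → (∀ {i j} → i < j → L j → L i) →
  ∃ λ c → c ≤ k × (∀ i → (L i → toℕ i <ⁿ c) × (toℕ i <ⁿ c → L i))
initialSegment {zero}  L? leftward = 0 , z≤n , λ ()
initialSegment {suc k} {L} L? leftward with L? zero
... | no ¬L₀ = 0 , z≤n , λ i → (λ Li → contradiction Li (¬L i)) , λ ()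
  where
  ¬L : ∀ i → ¬ L i
  ¬L zero    = ¬L₀
  ¬L (suc i) = ¬L₀ ∘ leftward (s≤s z≤n)
... | yes L₀ with initialSegment (L? ∘ suc) (leftward ∘ s≤s)
...   | c , c≤k , h = suc c , s≤s c≤k , λ where
  zero    → (λ _ → s≤s z≤n) , (λ _ → L₀)
  (suc i) → s≤s ∘ proj₁ (h i) , proj₂ (h i) ∘ s≤s⁻¹

-- Cutting f down to a map from `Fin c` to `Fin d` makes the pigeonhole principle applicable.
injection-≤ : ∀ {k} {f : Fin k → Fin k} {c d} → (∀ {i j} → f i ≡ f j → i ≡ j) → c ≤ k →
              (∀ i → toℕ i <ⁿ c → toℕ (f i) <ⁿ d) → c ≤ d
injection-≤ {k} {f} {c} {d} inj c≤k h = injective⇒≤ {f = g} λ {x} {y} eq →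
  toℕ-injective (trans (sym (toℕ-inject≤ x c≤k)) (trans (cong toℕ (inj (toℕ-injective
    (fromℕ<-injective _ _ (bound x) (bound y) eq)))) (toℕ-inject≤ y c≤k)))
  where
  bound : ∀ (x : Fin c) → toℕ (f (inject≤ x c≤k)) <ⁿ d
  bound x = h _ (subst (_<ⁿ c) (sym (toℕ-inject≤ x c≤k)) (toℕ<n x))

  g : Fin c → Fin d
  g x = fromℕ< (bound x)

-- Closure to the left makes L an initial segment of positions, of length c; closure downward makes
-- its values an initial segment, of length d. Since p maps one bijectively to the other, c = d.
closed⇒cut : ∀ {k} (p : Permutation′ k) {L : Fin k → Set} → (∀ i → Dec (L i)) →
  (∀ {i j} → i < j → L j → L i) → (∀ {i j} → p ⟨$⟩ʳ i < p ⟨$⟩ʳ j → L j → L i) →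
  ∃ λ c → c ≤ k × CutAt p c × (∀ i → (L i → toℕ i <ⁿ c) × (toℕ i <ⁿ c → L i))
closed⇒cut p {L} L? leftward below
  with initialSegment L? leftward
     | initialSegment (L? ∘ (p ⟨$⟩ˡ_)) (below ∘ subst₂ _<_ (sym (inverseʳ p)) (sym (inverseʳ p)))
... | c , c≤k , h | d , d≤k , h′ = c , c≤k , cut , h
  where
  position⇒value : ∀ i → toℕ i <ⁿ c → toℕ (p ⟨$⟩ʳ i) <ⁿ d
  position⇒value i lt = proj₁ (h′ (p ⟨$⟩ʳ i)) (subst L (sym (inverseˡ p)) (proj₂ (h i) lt))

  value⇒position : ∀ x → toℕ x <ⁿ d → toℕ (p ⟨$⟩ˡ x) <ⁿ c
  value⇒position x lt = proj₁ (h (p ⟨$⟩ˡ x)) (proj₂ (h′ x) lt)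

  c≡d : c ≡ d
  c≡d = ≤-antisym (injection-≤ {f = p ⟨$⟩ʳ_} (⟨$⟩ʳ-injective p) c≤k position⇒value)
                  (injection-≤ {f = p ⟨$⟩ˡ_} (⟨$⟩ʳ-injective (flip p)) d≤k value⇒position)

  cut : CutAt p c
  cut i = (λ lt → subst (toℕ (p ⟨$⟩ʳ i) <ⁿ_) (sym c≡d) (position⇒value i lt))
        , (λ lt → subst (λ x → toℕ x <ⁿ c) (inverseˡ p)
                    (value⇒position (p ⟨$⟩ʳ i) (subst (toℕ (p ⟨$⟩ʳ i) <ⁿ_) c≡d lt)))

-- Sums σ ⊕ id ⊕ τ

-- Coordinates in σ ⊕ id_m ⊕ τ. Labelling by block lets m change without arithmetic on positions.
-- Each summand occupies the same interval in positions and in values, so one type with one order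
-- `_◃_` serves for both.
data Block (a m b : ℕ) : Set where
  low  : Fin a → Block a m b
  mid  : Fin m → Block a m b
  high : Fin b → Block a m b

infix 4 _◃_

_◃_ : ∀ {a m b} → Block a m b → Block a m b → Set
low i  ◃ low j  = i < j
low _  ◃ mid _  = ⊤
low _  ◃ high _ = ⊤
mid _  ◃ low _  = ⊥
mid i  ◃ mid j  = i < j
mid _  ◃ high _ = ⊤
high _ ◃ low _  = ⊥
high _ ◃ mid _  = ⊥
high i ◃ high j = i < j

IsLow IsMid IsHigh : ∀ {a m b} → Block a m b → Set
IsLow (low _)   = ⊤
IsLow _         = ⊥
IsMid (mid _)   = ⊤
IsMid _         = ⊥
IsHigh (high _) = ⊤
IsHigh _        = ⊥

isLow? : ∀ {a m b} (x : Block a m b) → Dec (IsLow x)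
isLow? (low _)  = yes tt
isLow? (mid _)  = no λ ()
isLow? (high _) = no λ ()

isMid? : ∀ {a m b} (x : Block a m b) → Dec (IsMid x)
isMid? (low _)  = no λ ()
isMid? (mid _)  = yes tt
isMid? (high _) = no λ ()

isHigh? : ∀ {a m b} (x : Block a m b) → Dec (IsHigh x)
isHigh? (low _)  = no λ ()
isHigh? (mid _)  = no λ ()
isHigh? (high _) = yes tt

◃-low : ∀ {a m b} (x y : Block a m b) → x ◃ y → IsLow y → IsLow x
◃-low (low _) (low _) _ _ = tt

◃-¬high : ∀ {a m b} (x y : Block a m b) → x ◃ y → ¬ IsHigh y → ¬ IsHigh x
◃-¬high (high _) (high _) _ ¬h = ¬h

index : ∀ {a m b} → Block a m b → ℕ
index (low i)          = toℕ i
index {a} (mid i)      = a + toℕ i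
index {a} {m} (high i) = a + (m + toℕ i)

index-mono : ∀ {a m b} (x y : Block a m b) → x ◃ y → index x <ⁿ index y
index-mono         (low i)  (low j)  lt = lt
index-mono {a}     (low i)  (mid j)  _  = <-≤-trans (toℕ<n i) (m≤m+n a _)
index-mono {a}     (low i)  (high j) _  = <-≤-trans (toℕ<n i) (m≤m+n a _)
index-mono {a}     (mid i)  (mid j)  lt = +-monoʳ-< a lt
index-mono {a} {m} (mid i)  (high j) _  = +-monoʳ-< a (<-≤-trans (toℕ<n i) (m≤m+n m _))
index-mono {a} {m} (high i) (high j) lt = +-monoʳ-< a (+-monoʳ-< m lt)

index-cancel : ∀ {a m b} (x y : Block a m b) → index x <ⁿ index y → x ◃ y
index-cancel         (low i)  (low j)  lt = lt
index-cancel         (low i)  (mid j)  _  = tt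
index-cancel         (low i)  (high j) _  = tt
index-cancel {a}     (mid i)  (low j)  lt = m+n≮m a _ (<-trans lt (toℕ<n j))
index-cancel {a}     (mid i)  (mid j)  lt = +-cancelˡ-< a _ _ lt
index-cancel         (mid i)  (high j) _  = tt
index-cancel {a}     (high i) (low j)  lt = m+n≮m a _ (<-trans lt (toℕ<n j))
index-cancel {a} {m} (high i) (mid j)  lt = m+n≮m m _ (<-trans (+-cancelˡ-< a _ _ lt) (toℕ<n j))
index-cancel {a} {m} (high i) (high j) lt = +-cancelˡ-< m _ _ (+-cancelˡ-< a _ _ lt)

-- These are the values under a first entry that exceeds σ, the middle block and w entries of τ. As
-- w counts entries of τ alone, the condition is stable under a change of m.
Below : ∀ {a m b} → ℕ → Block a m b → Set
Below w (high i) = toℕ i <ⁿ w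
Below w _        = ⊤

¬high⇒below : ∀ {a m b w} (x : Block a m b) → ¬ IsHigh x → Below w x
¬high⇒below (low _)  _  = tt
¬high⇒below (mid _)  _  = tt
¬high⇒below (high _) ¬h = contradiction tt ¬h

index<⇒below : ∀ {a m b w} (x : Block a m b) → index x <ⁿ a + (m + w) → Below w x
index<⇒below         (low _)  _  = tt
index<⇒below         (mid _)  _  = tt
index<⇒below {a} {m} (high i) lt = +-cancelˡ-< m _ _ (+-cancelˡ-< a _ _ lt)

below⇒index< : ∀ {a m b w} (x : Block a m b) → Below w x → index x <ⁿ a + (m + w)
below⇒index< {a}     (low i)  _  = <-≤-trans (toℕ<n i) (m≤m+n a _)
below⇒index< {a} {m} (mid i)  _  = +-monoʳ-< a (<-≤-trans (toℕ<n i) (m≤m+n m _))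
below⇒index< {a} {m} (high i) lt = +-monoʳ-< a (+-monoʳ-< m lt)

-- Frees one middle slot by sending the first middle entry to the slot y of σ. Order is preserved as
-- long as the low block or the middle block is unoccupied.
lowShift : ∀ {a m b} → Fin a → Block a (suc m) b → Block a m b
lowShift y (low i)       = low i
lowShift y (mid zero)    = low y
lowShift y (mid (suc i)) = mid i
lowShift y (high i)      = high i

lowShift-mono : ∀ {a m b} (y : Fin a) (u v : Block a (suc m) b) → ¬ IsLow u → ¬ IsLow v →
                u ◃ v → lowShift y u ◃ lowShift y v
lowShift-mono y (low _) _ ¬l _ _ = contradiction tt ¬l
lowShift-mono y _ (low _) _ ¬l _ = contradiction tt ¬l
lowShift-mono y (mid zero)    (mid (suc j)) _ _ _        = tt
lowShift-mono y (mid (suc i)) (mid (suc j)) _ _ (s≤s lt) = lt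
lowShift-mono y (mid zero)    (high j)      _ _ _        = tt
lowShift-mono y (mid (suc i)) (high j)      _ _ _        = tt
lowShift-mono y (high i)      (high j)      _ _ lt       = lt

lowShift-mono′ : ∀ {a m b} (y : Fin a) (u v : Block a (suc m) b) → ¬ IsMid u → ¬ IsMid v →
                 u ◃ v → lowShift y u ◃ lowShift y v
lowShift-mono′ y (mid _) _ ¬m _ _ = contradiction tt ¬m
lowShift-mono′ y _ (mid _) _ ¬m _ = contradiction tt ¬m
lowShift-mono′ y (low i)  (low j)  _ _ lt = lt
lowShift-mono′ y (low i)  (high j) _ _ _  = tt
lowShift-mono′ y (high i) (high j) _ _ lt = lt

lowShift-high : ∀ {a m b} (y : Fin a) (u : Block a (suc m) b) → IsHigh (lowShift y u) → IsHigh u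
lowShift-high y (high _)      _ = tt
lowShift-high y (mid zero)    ()
lowShift-high y (mid (suc _)) ()

lowShift-below : ∀ {a m b w} (y : Fin a) (u : Block a (suc m) b) → Below w u → Below w (lowShift y u)
lowShift-below y (low _)       _  = tt
lowShift-below y (mid zero)    _  = tt
lowShift-below y (mid (suc _)) _  = tt
lowShift-below y (high _)      lt = lt

-- Frees one middle slot at the other end: the last middle entry, recognised by i ≮ m, goes to the
-- slot x of τ. This preserves order while τ is unoccupied.
highShift : ∀ {a m b} → Fin b → Block a (suc m) b → Block a m b
highShift         x (low i)  = low i
highShift {m = m} x (mid i) with toℕ i <? m
... | yes lt = mid (fromℕ< lt)
... | no  _  = high x
highShift         x (high i) = high i

highShift-mono : ∀ {a m b} (x : Fin b) (u v : Block a (suc m) b) → ¬ IsHigh u → ¬ IsHigh v →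
                 u ◃ v → highShift x u ◃ highShift x v
highShift-mono x (high _) _ ¬h _ _ = contradiction tt ¬h
highShift-mono x _ (high _) _ ¬h _ = contradiction tt ¬h
highShift-mono x (low i) (low j) _ _ lt = lt
highShift-mono {m = m} x (low i) (mid j) _ _ _ with toℕ j <? m
... | yes _ = tt
... | no  _ = tt
highShift-mono {m = m} x (mid i) (mid j) _ _ lt with toℕ i <? m | toℕ j <? m
... | yes l | yes l′ = subst₂ _<ⁿ_ (sym (toℕ-fromℕ< l)) (sym (toℕ-fromℕ< l′)) lt
... | yes _ | no  _  = tt
... | no ¬l | _      = contradiction (<-≤-trans lt (toℕ≤pred[n] j)) ¬l

highShift-below : ∀ {a m b w} (x : Fin b) (u : Block a (suc m) b) → ¬ IsHigh u →
                  toℕ x <ⁿ w → Below w (highShift x u)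
highShift-below         x (low i)  _  _  = tt
highShift-below {m = m} x (mid i)  _  lt with toℕ i <? m
... | yes _ = tt
... | no  _ = lt
highShift-below         x (high i) ¬h _  = contradiction tt ¬h

-- Serves to relocate a single entry lying in τ: with at most one such entry, sending all of τ to
-- one slot preserves order.
collapseHigh : ∀ {a m b} → Fin b → Block a m b → Block a m b
collapseHigh x (low i)  = low i
collapseHigh x (mid i)  = mid i
collapseHigh x (high _) = high x

collapseHigh-mono : ∀ {a m b} (x : Fin b) (u v : Block a m b) → (IsHigh u → ¬ IsHigh v) →
                    u ◃ v → collapseHigh x u ◃ collapseHigh x v
collapseHigh-mono x (low i)  (low j)  _ lt = lt
collapseHigh-mono x (low i)  (mid j)  _ _  = tt
collapseHigh-mono x (low i)  (high j) _ _  = tt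
collapseHigh-mono x (mid i)  (mid j)  _ lt = lt
collapseHigh-mono x (mid i)  (high j) _ _  = tt
collapseHigh-mono x (high i) (high j) h _  = contradiction tt (h tt)

collapseHigh-below : ∀ {a m b w} (x : Fin b) (u : Block a m b) → ¬ IsHigh u → Below w (collapseHigh x u)
collapseHigh-below x (low _)  _  = tt
collapseHigh-below x (mid _)  _  = tt
collapseHigh-below x (high _) ¬h = contradiction tt ¬h

collapseHigh-above : ∀ {a m b w} (x : Fin b) (u : Block a m b) → IsHigh u → w ≤ toℕ x →
                     ¬ Below w (collapseHigh x u)
collapseHigh-above x (high _) _ le lt = <⇒≱ lt le

-- Embeddings into a sum in block coordinates

module Sum {a b} (σ : Permutation′ a) (τ : Permutation′ b) where

  val : ∀ {m} → Block a m b → Block a m b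
  val (low i)  = low (σ ⟨$⟩ʳ i)
  val (mid i)  = mid i
  val (high i) = high (τ ⟨$⟩ʳ i)

  val-low : ∀ {m} (u : Block a m b) → IsLow (val u) → IsLow u
  val-low (low _) _ = tt

  low-val : ∀ {m} (u : Block a m b) → IsLow u → IsLow (val u)
  low-val (low _) _ = tt

  val-mid : ∀ {m} (u : Block a m b) → IsMid (val u) → IsMid u
  val-mid (mid _) _ = tt

  val-high : ∀ {m} (u : Block a m b) → IsHigh (val u) → IsHigh u
  val-high (high _) _ = tt

  high-val : ∀ {m} (u : Block a m b) → IsHigh u → IsHigh (val u)
  high-val (high _) _ = tt

  -- A shift of positions into the slot y is matched on values by the shift into the slot σ(y), so
  -- moving entries this way stays inside the graph of the permutation.
  val-lowShift : ∀ {m} y (u : Block a (suc m) b) → val (lowShift y u) ≡ lowShift (σ ⟨$⟩ʳ y) (val u)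
  val-lowShift y (low i)       = refl
  val-lowShift y (mid zero)    = refl
  val-lowShift y (mid (suc i)) = refl
  val-lowShift y (high i)      = refl

  val-highShift : ∀ {m} x (u : Block a (suc m) b) → val (highShift x u) ≡ highShift (τ ⟨$⟩ʳ x) (val u)
  val-highShift     x (low i)  = refl
  val-highShift {m} x (mid i) with toℕ i <? m
  ... | yes _ = refl
  ... | no  _ = refl
  val-highShift     x (high i) = refl

  val-collapseHigh : ∀ {m} x (u : Block a m b) → val (collapseHigh x u) ≡ collapseHigh (τ ⟨$⟩ʳ x) (val u)
  val-collapseHigh x (low _)  = refl
  val-collapseHigh x (mid _)  = refl
  val-collapseHigh x (high _) = refl

  -- Block coordinates on a permutation that equals the sum up to `≅`. The equation of lengths is
  -- matched once, when the model is built, and is afterwards only a field.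
  record Model {n} (π : Permutation′ n) (m : ℕ) : Set where
    field
      length≡    : n ≡ a + (m + b)
      middle-cut : CutAt π (a + m)
      to         : Fin n → Block a m b
      from       : Block a m b → Fin n
      from-to    : ∀ x → from (to x) ≡ x
      toℕ-from   : ∀ u → toℕ (from u) ≡ index u
      π-from     : ∀ u → π ⟨$⟩ʳ from u ≡ from (val u)

    position : ∀ x → toℕ x ≡ index (to x)
    position x = trans (cong toℕ (sym (from-to x))) (toℕ-from (to x))

    value : ∀ x → toℕ (π ⟨$⟩ʳ x) ≡ index (val (to x))
    value x = trans (cong (λ y → toℕ (π ⟨$⟩ʳ y)) (sym (from-to x)))
                    (trans (cong toℕ (π-from (to x))) (toℕ-from (val (to x))))

    value-from : ∀ u → toℕ (π ⟨$⟩ʳ from u) ≡ index (val u)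
    value-from u = trans (cong toℕ (π-from u)) (toℕ-from (val u))

  model : ∀ {n} {π : Permutation′ n} {m} → π ≅ σ ⊕ Perm.id {m} ⊕ τ → Model π m
  model {n} {π} {m} (refl ,≈ eq) = record
    { length≡    = refl
    ; middle-cut = subst (λ k → CutAt π (a + k)) (+-identityʳ m)
        (cutAt-resp-≈ {π = X} {π} (sym ∘ eq)
          (cutAt-⊕ σ (Perm.id {m} ⊕ τ) (cutAt-⊕ (Perm.id {m}) τ (cutAt-zero τ))))
    ; to = proj₁ ∘ locate ; from = from
    ; from-to = proj₂ ∘ locate ; toℕ-from = toℕ-from ; π-from = λ u → trans (eq (from u)) (X-from u) }
    where
    X : Permutation′ (a + (m + b))
    X = σ ⊕ Perm.id {m} ⊕ τ

    from : Block a m b → Fin (a + (m + b))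
    from (low i)  = i ↑ˡ (m + b)
    from (mid i)  = a ↑ʳ (i ↑ˡ b)
    from (high i) = a ↑ʳ (m ↑ʳ i)

    locate : ∀ x → ∃ λ u → from u ≡ x
    locate x with side a {m + b} x
    ... | left i  = low i , refl
    ... | right y with side m {b} y
    ...   | left i  = mid i , refl
    ...   | right i = high i , refl

    toℕ-from : ∀ u → toℕ (from u) ≡ index u
    toℕ-from (low i)  = toℕ-↑ˡ i (m + b)
    toℕ-from (mid i)  = trans (toℕ-↑ʳ a (i ↑ˡ b)) (cong (a +_) (toℕ-↑ˡ i b))
    toℕ-from (high i) = trans (toℕ-↑ʳ a (m ↑ʳ i)) (cong (a +_) (toℕ-↑ʳ m i))

    X-from : ∀ u → X ⟨$⟩ʳ from u ≡ from (val u)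
    X-from (low i)  = ⊕-ˡ σ (Perm.id {m} ⊕ τ) i
    X-from (mid i)  = trans (⊕-ʳ σ (Perm.id {m} ⊕ τ) (i ↑ˡ b)) (cong (a ↑ʳ_) (⊕-ˡ (Perm.id {m}) τ i))
    X-from (high i) = trans (⊕-ʳ σ (Perm.id {m} ⊕ τ) (m ↑ʳ i)) (cong (a ↑ʳ_) (⊕-ʳ (Perm.id {m}) τ i))

  record Embedding {k} (p : Permutation′ k) (m : ℕ) : Set where
    field
      place : Fin k → Block a m b
      pos   : ∀ {i j} → i < j → place i ◃ place j
      ord   : ∀ {i j} → p ⟨$⟩ʳ i < p ⟨$⟩ʳ j → val (place i) ◃ val (place j)

  open Embedding

  module _ {n} {π : Permutation′ n} {m} (M : Model π m) where
    open Model M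

    ≼⇒embedding : ∀ {k} {p : Permutation′ k} → p ≼ π → Embedding p m
    ≼⇒embedding {p = p} em@(ι , mono , _) = record
      { place = to ∘ ι
      ; pos   = λ lt → index-cancel _ _ (subst₂ _<ⁿ_ (position _) (position _) (mono lt))
      ; ord   = λ lt → index-cancel _ _ (subst₂ _<ⁿ_ (value _) (value _) (≼-order {p = p} {π} em lt)) }

    embedding⇒≼ : ∀ {k} {p : Permutation′ k} → Embedding p m → p ≼ π
    embedding⇒≼ {p = p} E = mk≼ {p = p} {π} (from ∘ place E)
      (λ lt → subst₂ _<ⁿ_ (sym (toℕ-from _)) (sym (toℕ-from _)) (index-mono _ _ (pos E lt)))
      (λ lt → subst₂ _<ⁿ_ (sym (value-from _)) (sym (value-from _)) (index-mono _ _ (ord E lt)))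

  -- Here g moves positions and g′ moves values. Monotonicity is asked only between distinct entries
  -- of p, since the shifts preserve order only when some block is sparsely occupied.
  mapEmbedding : ∀ {k} {p : Permutation′ k} {m m′} (E : Embedding p m) (g g′ : Block a m b → Block a m′ b) →
    (∀ u → val (g u) ≡ g′ (val u)) →
    (∀ {i j} → i ≢ j → place E i ◃ place E j → g (place E i) ◃ g (place E j)) →
    (∀ {i j} → i ≢ j → val (place E i) ◃ val (place E j) → g′ (val (place E i)) ◃ g′ (val (place E j))) →
    Embedding p m′
  mapEmbedding {p = p} E g g′ val-g mono mono′ = record
    { place = g ∘ place E
    ; pos   = λ lt → mono (λ { refl → <-irrefl refl lt }) (pos E lt)
    ; ord   = λ lt → subst₂ _◃_ (sym (val-g _)) (sym (val-g _)) (mono′ (λ { refl → <-irrefl refl lt }) (ord E lt)) }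

  embed-¬low : ∀ {k} {p : Permutation′ k} {m} (E : Embedding p (suc m)) → Fin a →
               ¬ (∃ λ i → IsLow (place E i)) → Embedding p m
  embed-¬low E y ¬low = mapEmbedding E (lowShift y) (lowShift (σ ⟨$⟩ʳ y)) (val-lowShift y)
    (λ {i} {j} _ → lowShift-mono y _ _ (¬low ∘ (i ,_)) (¬low ∘ (j ,_)))
    (λ {i} {j} _ → lowShift-mono (σ ⟨$⟩ʳ y) _ _ (¬low ∘ (i ,_) ∘ val-low _) (¬low ∘ (j ,_) ∘ val-low _))

  embed-¬mid : ∀ {k} {p : Permutation′ k} {m} (E : Embedding p (suc m)) → Fin a →
               ¬ (∃ λ i → IsMid (place E i)) → Embedding p m
  embed-¬mid E y ¬mid = mapEmbedding E (lowShift y) (lowShift (σ ⟨$⟩ʳ y)) (val-lowShift y)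
    (λ {i} {j} _ → lowShift-mono′ y _ _ (¬mid ∘ (i ,_)) (¬mid ∘ (j ,_)))
    (λ {i} {j} _ → lowShift-mono′ (σ ⟨$⟩ʳ y) _ _ (¬mid ∘ (i ,_) ∘ val-mid _) (¬mid ∘ (j ,_) ∘ val-mid _))

  embed-¬high : ∀ {k} {p : Permutation′ k} {m} (E : Embedding p (suc m)) → Fin b →
                ¬ (∃ λ i → IsHigh (place E i)) → Embedding p m
  embed-¬high E x ¬high = mapEmbedding E (highShift x) (highShift (τ ⟨$⟩ʳ x)) (val-highShift x)
    (λ {i} {j} _ → highShift-mono x _ _ (¬high ∘ (i ,_)) (¬high ∘ (j ,_)))
    (λ {i} {j} _ → highShift-mono (τ ⟨$⟩ʳ x) _ _ (¬high ∘ (i ,_) ∘ val-high _) (¬high ∘ (j ,_) ∘ val-high _))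

  -- Whatever lies to the left of or below an entry in σ is itself in σ.
  low-cut : ∀ {k} {p : Permutation′ k} {m} (E : Embedding p m) →
    ∃ λ c → c ≤ k × CutAt p c × (∀ i → (IsLow (place E i) → toℕ i <ⁿ c) × (toℕ i <ⁿ c → IsLow (place E i)))
  low-cut {p = p} E = closed⇒cut p (isLow? ∘ place E) (◃-low _ _ ∘ pos E)
    (λ lt → val-low _ ∘ ◃-low _ _ (ord E lt) ∘ low-val _)

  ¬high-cut : ∀ {k} {p : Permutation′ k} {m} (E : Embedding p m) →
    ∃ λ c → c ≤ k × CutAt p c × (∀ i → (¬ IsHigh (place E i) → toℕ i <ⁿ c) × (toℕ i <ⁿ c → ¬ IsHigh (place E i)))
  ¬high-cut {p = p} E = closed⇒cut p (¬? ∘ isHigh? ∘ place E) (◃-¬high _ _ ∘ pos E)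
    (λ lt ¬h → ◃-¬high _ _ (ord E lt) (¬h ∘ val-high _) ∘ high-val _)

  mid⇒¬low : ∀ {m} (u : Block a m b) → IsMid u → ¬ IsLow u
  mid⇒¬low (mid _) _ ()

  mid⇒¬high : ∀ {m} (u : Block a m b) → IsMid u → ¬ IsHigh u
  mid⇒¬high (mid _) _ ()

  shrink : ∀ {k} {p : Permutation′ k} {m} → Fin a → Fin b → Embedding p (suc m) →
           Embedding p m ⊎ comp p ≥ 3
  shrink {p = p} y x E
    with any? (isLow? ∘ place E) | any? (isMid? ∘ place E) | any? (isHigh? ∘ place E)
  ... | no ¬l | _     | _     = inj₁ (embed-¬low E y ¬l)
  ... | yes _ | no ¬m | _     = inj₁ (embed-¬mid E y ¬m)
  ... | yes _ | yes _ | no ¬h = inj₁ (embed-¬high E x ¬h)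
  -- All three blocks are met: i makes the first cut positive, the middle entry j separates the two
  -- cuts, and h lies beyond the second.
  ... | yes (i , l) | yes (j , m) | yes (h , hi) with low-cut E | ¬high-cut E
  ...   | c , _ , cut , f | d , _ , cut′ , g = inj₂ (cuts⇒comp≥3 {π = p}
    (≤-<-trans z≤n (proj₁ (f i) l))
    (≤-<-trans (≮⇒≥ (mid⇒¬low _ m ∘ proj₂ (f j))) (proj₁ (g j) (mid⇒¬high _ m)))
    (≤-<-trans (≮⇒≥ λ lt → proj₂ (g h) lt hi) (toℕ<n h)) cut cut′)

-- The first case of the definition of f

cutAt-last : ∀ {k} {p : Permutation′ (suc k)} → toℕ (p ⟨$⟩ʳ fromℕ k) ≡ k → CutAt p k
cutAt-last {k} {p} last≡k i with m≤n⇒m<n∨m≡n (toℕ≤pred[n] i)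
... | inj₂ i≡k = (λ lt → contradiction i≡k (<⇒≢ lt)) , (λ lt → contradiction pi≡k (<⇒≢ lt))
  where
  pi≡k : toℕ (p ⟨$⟩ʳ i) ≡ k
  pi≡k = trans (cong (λ x → toℕ (p ⟨$⟩ʳ x)) (toℕ-injective (trans i≡k (sym (toℕ-fromℕ k))))) last≡k
... | inj₁ i<k = (λ _ → pi<k) , (λ _ → i<k)
  where
  pi<k : toℕ (p ⟨$⟩ʳ i) <ⁿ k
  pi<k = ≤∧≢⇒< (toℕ≤pred[n] _) λ e → <⇒≢ i<k
    (trans (cong toℕ (⟨$⟩ʳ-injective p (toℕ-injective (trans e (sym last≡k))))) (toℕ-fromℕ k))

tail-≼ : ∀ {k n} {p : Permutation′ k} {π : Permutation′ (suc n)} → p ≼ tail π → p ≼ π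
tail-≼ {p = p} {π} em@(ι , mono , _) = mk≼ {p = p} {π} (suc ∘ ι) (s≤s ∘ mono)
  (λ lt → tail-mono π (≼-order {p = p} {tail π} em lt))

-- Conditions (a)–(d) for p itself.  In (c) the entry pₙ may be the largest one
-- only if π begins with its largest entry.
data Case₁Conclusion {k n} (p : Permutation′ (suc k)) (π : Permutation′ (suc n)) : Set where
  condition-a : comp p ≥ 3 → Case₁Conclusion p π
  condition-b : comp (tail p) >ⁿ comp p → Case₁Conclusion p π
  condition-c : 0 <ⁿ first p → comp p ≡ 2 → FirstComponentBeginsWithLargest p →
                toℕ (p ⟨$⟩ʳ fromℕ k) <ⁿ k ⊎ first π ≡ n → Case₁Conclusion p π
  condition-d : 0 <ⁿ first p → first p <ⁿ k → tail p Avoids pattern-213 → Case₁Conclusion p π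

module FirstEntry {a b} (σ : Permutation′ (suc a)) (τ : Permutation′ (suc b)) where

  open Sum σ τ
  open Embedding

  -- The first entry of p goes to a first entry lying above the low and middle
  -- blocks and the w least entries of the high block.
  record TopEmbedding {k} (p : Permutation′ (suc k)) (m w : ℕ) : Set where
    field
      rest  : Embedding (tail p) m
      below : ∀ i → toℕ (tail p ⟨$⟩ʳ i) <ⁿ first p → Below w (val (place rest i))
      above : ∀ i → first p ≤ toℕ (tail p ⟨$⟩ʳ i) → ¬ Below w (val (place rest i))

  -- Since `first π` is the number of smaller values, a tail entry is below π₁ exactly when its
  -- value satisfies `Below w`. So `below` and `above` supply the comparisons with the first entry.
  topEmbedding⇒≼ : ∀ {k n} {p : Permutation′ (suc k)} {π : Permutation′ (suc n)} {m w} →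
    Model (tail π) m → first π ≡ suc a + (m + w) → TopEmbedding p m w → p ≼ π
  topEmbedding⇒≼ {k} {n} {p} {π} {m} {w} M first≡ T =
    mk≼ {p = p} {π} ι (λ {i} {j} → mono i j) (λ {i} {j} → order i j)
    where
    open TopEmbedding T
    open Model M
    tail-em : tail p ≼ tail π
    tail-em = embedding⇒≼ M rest

    ι : Fin (suc k) → Fin (suc n)
    ι zero    = zero
    ι (suc i) = suc (from (place rest i))

    mono : ∀ i j → i < j → ι i < ι j
    mono zero    (suc j) _        = s≤s z≤n
    mono (suc i) (suc j) (s≤s lt) = s≤s (≼-mono {p = tail p} {tail π} tail-em lt)

    order : ∀ i j → p ⟨$⟩ʳ i < p ⟨$⟩ʳ j → π ⟨$⟩ʳ ι i < π ⟨$⟩ʳ ι j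
    order zero    zero    lt = contradiction lt (<-irrefl refl)
    order (suc i) (suc j) lt = tail-mono π (≼-order {p = tail p} {tail π} tail-em (tail-cancel p lt))
    order (suc i) zero    lt = subst (_<ⁿ first π) (sym (tail-below π _ tail<)) tail<
      where
      tail< : toℕ (tail π ⟨$⟩ʳ from (place rest i)) <ⁿ first π
      tail< = subst₂ _<ⁿ_ (sym (value-from _)) (sym first≡) (below⇒index< _ (below i (<first⇒tail< p lt)))
    order zero    (suc j) lt = subst (first π <ⁿ_) (sym (tail-above π _ first≤)) (s≤s first≤)
      where
      first≤ : first π ≤ toℕ (tail π ⟨$⟩ʳ from (place rest j))
      first≤ = ≮⇒≥ λ tail< → above j (first<⇒≤tail p lt)
        (index<⇒below _ (subst₂ _<ⁿ_ (value-from _) first≡ tail<))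

  ≼⇒topEmbedding : ∀ {k n} {p : Permutation′ (suc k)} {ρ : Permutation′ (suc n)} {m w} →
    Model (tail ρ) m → first ρ ≡ suc a + (m + w) → (em : p ≼ ρ) → proj₁ em zero ≡ zero → TopEmbedding p m w
  ≼⇒topEmbedding {k} {n} {p} {ρ} {m} {w} M first≡ em@(ι , mono , _) ι₀≡0 = record
    { rest = ≼⇒embedding M {p = tail p} (mk≼ {p = tail p} {tail ρ} ι′
        (λ {i} {j} lt → s≤s⁻¹ (subst₂ _<_ (ι-suc i) (ι-suc j) (mono (s≤s lt))))
        (λ {i} {j} lt → tail-cancel ρ (subst₂ (λ x y → ρ ⟨$⟩ʳ x < ρ ⟨$⟩ʳ y) (ι-suc i) (ι-suc j)
          (≼-order {p = p} {ρ} em (tail-mono p lt)))))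
    ; below = λ i lt → index<⇒below _ (subst₂ _<ⁿ_ (value (ι′ i)) first≡ (<first⇒tail< ρ
        (subst₂ (λ x y → ρ ⟨$⟩ʳ x < ρ ⟨$⟩ʳ y) (ι-suc i) ι₀≡0
          (≼-order {p = p} {ρ} em (subst (_<ⁿ first p) (sym (tail-below p i lt)) lt)))))
    ; above = λ i le B → <⇒≱ (below⇒index< _ B) (subst₂ _≤_ first≡ (value (ι′ i)) (first<⇒≤tail ρ
        (subst₂ (λ x y → ρ ⟨$⟩ʳ x < ρ ⟨$⟩ʳ y) ι₀≡0 (ι-suc i)
          (≼-order {p = p} {ρ} em (subst (first p <ⁿ_) (sym (tail-above p i le)) (s≤s le)))))) }
    where
    open Model M

    positive : ∀ i → ∃ λ x → ι (suc i) ≡ suc x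
    positive i with ι (suc i) | mono {zero} {suc i} (s≤s z≤n)
    ... | suc x | _ = x , refl

    ι′ : Fin k → Fin n
    ι′ = proj₁ ∘ positive

    ι-suc : ∀ i → ι (suc i) ≡ suc (ι′ i)
    ι-suc = proj₂ ∘ positive

  -- Here π is π₁ followed by σ ⊕ id_m ⊕ τ, and p embeds into π₁ followed by
  -- σ ⊕ id_{m+1} ⊕ τ.  The values of σ and id lie below π₁; since π₁ is the same
  -- number in both, it lies above one more entry of τ in π.
  module _ {k n} {p : Permutation′ (suc k)} {π : Permutation′ (suc n)} {m w}
           (M : Model (tail π) m) (first≡ : first π ≡ suc a + (m + suc w))
           (T : TopEmbedding p (suc m) w) (p⋠π : π Avoids p) where

    open TopEmbedding T
    open Model M using (length≡)

    private
      at : Fin k → Block (suc a) (suc m) (suc b)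
      at = place rest

    all-high⇒¬low : (∀ i → IsHigh (at i)) → ¬ (∃ λ i → IsLow (at i))
    all-high⇒¬low high′ (i , l) with at i | high′ i
    ... | high _ | _ = l

    -- The tail of p keeps its place in τ, and the least entry p₁ can be put on the first entry of
    -- σ, so that p embeds into the tail of π already.
    all-high-least : (∀ i → IsHigh (at i)) → first p ≡ 0 → p ≼ π
    all-high-least high′ first≡0 = tail-≼ {p = p} {π} (embedding⇒≼ M {p = p} E)
      where
      E₀ : Embedding (tail p) m
      E₀ = embed-¬low rest zero (all-high⇒¬low high′)

      low₀◃ : (u : Block (suc a) (suc m) (suc b)) → IsHigh u →
              low zero ◃ lowShift zero u × val {m} (low zero) ◃ val (lowShift zero u)
      low₀◃ (high _) _ = tt , tt

      E : Embedding p m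
      E = record
        { place = λ { zero → low zero ; (suc i) → place E₀ i }
        ; pos   = λ { {zero} {suc j} _ → proj₁ (low₀◃ (at j) (high′ j))
                    ; {suc i} {suc j} (s≤s lt) → pos E₀ lt }
        ; ord   = λ { {zero}  {zero}  lt → contradiction lt (<-irrefl refl)
                    ; {zero}  {suc j} _  → proj₂ (low₀◃ (at j) (high′ j))
                    ; {suc i} {zero}  lt → contradiction (subst (toℕ (p ⟨$⟩ʳ suc i) <ⁿ_) first≡0 lt) λ ()
                    ; {suc i} {suc j} lt → ord E₀ (tail-cancel p lt) } }

    below-top : first p ≡ k → ∀ i → toℕ (tail p ⟨$⟩ʳ i) <ⁿ first p
    below-top first≡k i = subst (toℕ (tail p ⟨$⟩ʳ i) <ⁿ_) (sym first≡k) (toℕ<n _)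

    -- When p₁ exceeds all other entries, `above` is vacuous and raising w to w + 1 only weakens
    -- `below`, so p₁ can go to π₁.
    all-high-greatest : (∀ i → IsHigh (at i)) → first p ≡ k → p ≼ π
    all-high-greatest high′ first≡k = topEmbedding⇒≼ {p = p} {π} M first≡ record
      { rest  = embed-¬low rest zero (all-high⇒¬low high′)
      ; below = λ i lt → subst (Below (suc w)) (sym (val-lowShift zero (at i)))
          (lowShift-below _ (val (at i)) (below-suc (val (at i)) (below i lt)))
      ; above = λ i le → contradiction (below-top first≡k i) (≤⇒≯ le) }
      where
      below-suc : (u : Block (suc a) (suc m) (suc b)) → Below w u → Below (suc w) u
      below-suc (low _)  _  = tt
      below-suc (mid _)  _  = tt
      below-suc (high _) lt = m<n⇒m<1+n lt

    all-high⇒≼τ : (∀ i → IsHigh (at i)) → tail p ≼ τ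
    all-high⇒≼τ high′ = mk≼ {p = tail p} {τ} (λ i → proj₁ (slot i))
      (λ {i} {j} lt → subst₂ _◃_ (proj₂ (slot i)) (proj₂ (slot j)) (pos rest lt))
      (λ {i} {j} lt → subst₂ (λ u v → val u ◃ val v) (proj₂ (slot i)) (proj₂ (slot j)) (ord rest lt))
      where
      slot : ∀ i → ∃ λ j → at i ≡ high j
      slot i with at i | high′ i
      ... | high j | _ = j , refl

    all-high : τ Avoids pattern-213 → (∀ i → IsHigh (at i)) → Case₁Conclusion p π
    all-high avoids high′ with first p ≟ 0 | first p ≟ k
    ... | yes e | _     = contradiction (all-high-least high′ e) p⋠π
    ... | no _  | yes e = contradiction (all-high-greatest high′ e) p⋠π
    ... | no ≢0 | no ≢k = condition-d
      (n≢0⇒n>0 ≢0) (≤∧≢⇒< (toℕ≤pred[n] (p ⟨$⟩ʳ zero)) ≢k)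
      (λ em → avoids (≼-trans {p = pattern-213} {tail p} {τ} em (all-high⇒≼τ high′)))

    -- Otherwise the tail entry next above p₁ in value would lie inside the cut, hence outside τ,
    -- hence under the first entry, against `above`.
    first≤cut : ∀ {c} → c ≤ k → CutAt (tail p) c → (∀ i → toℕ i <ⁿ c → ¬ IsHigh (at i)) → c ≤ first p
    first≤cut {c} c≤k cut ¬high = ≮⇒≥ λ first<c →
      let x = fromℕ< (<-≤-trans first<c c≤k)
          j = tail p ⟨$⟩ˡ x
          value-j : toℕ (tail p ⟨$⟩ʳ j) ≡ first p
          value-j = trans (cong toℕ (inverseʳ (tail p))) (toℕ-fromℕ< _)
      in above j (≤-reflexive (sym value-j))
           (¬high⇒below _ (¬high j (proj₂ (cut j) (subst (_<ⁿ c) (sym value-j) first<c)) ∘ val-high (at j)))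

    -- The displaced middle entry goes to the least value of τ. This is under π₁, because w + 1
    -- entries of τ are.
    no-high-greatest : first p ≡ k → (∀ i → ¬ IsHigh (at i)) → p ≼ π
    no-high-greatest first≡k ¬high = topEmbedding⇒≼ {p = p} {π} M first≡ record
      { rest  = embed-¬high rest (τ ⟨$⟩ˡ zero) λ (i , h) → ¬high i h
      ; below = λ i _ → subst (Below (suc w)) (sym (val-highShift _ (at i)))
          (highShift-below _ (val (at i)) (¬high i ∘ val-high (at i))
            (subst (λ x → toℕ x <ⁿ suc w) (sym (inverseʳ τ)) (s≤s z≤n)))
      ; above = λ i le → contradiction (below-top first≡k i) (≤⇒≯ le) }

    -- Only the last entry of p, which is also its largest, lies in τ, so it may be moved freely
    -- there. It goes to the entry of τ with value w + 1, the least one above π₁; such an entry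
    -- exists because π₁ is not the largest entry of π.
    one-high : CutAt (tail p) (first p) →
      (∀ i → (¬ IsHigh (at i) → toℕ i <ⁿ first p) × (toℕ i <ⁿ first p → ¬ IsHigh (at i))) →
      suc (first p) ≡ k → first π ≢ n → (E : Embedding (tail p) m) → (∀ i → place E i ≡ lowShift zero (at i)) →
      p ≼ π
    one-high cut f 1+first≡k first≢n E place≡ = topEmbedding⇒≼ {p = p} {π} M first≡ record
      { rest  = mapEmbedding E (collapseHigh x) (collapseHigh y)
          (λ u → trans (val-collapseHigh x u) (cong (λ z → collapseHigh z (val u)) (inverseʳ τ)))
          (λ i≢j → collapseHigh-mono x _ _ (λ h h′ → i≢j (unique h h′)))
          (λ i≢j → collapseHigh-mono y _ _ (λ h h′ → i≢j (unique (val-high _ h) (val-high _ h′))))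
      ; below = λ i lt → subst (Below (suc w)) (sym (val-place i))
          (collapseHigh-below y _ (proj₂ (f i) (proj₂ (cut i) lt) ∘ shifted-high i ∘ val-high _))
      ; above = λ i le B → collapseHigh-above y (val (place E i))
          (high-val _ (subst IsHigh (sym (place≡ i)) (lowShift-stays-high (at i) (is-high i le))))
          (≤-reflexive (sym (toℕ-fromℕ< 1+w<b))) (subst (Below (suc w)) (val-place i) B) }
      where
      1+w<b : suc w <ⁿ suc b
      1+w<b = +-cancelˡ-< m _ _ (+-cancelˡ-< (suc a) _ _ (subst₂ _<ⁿ_ first≡ length≡
                (≤∧≢⇒< (toℕ≤pred[n] (π ⟨$⟩ʳ zero)) first≢n)))

      y x : Fin (suc b)
      y = fromℕ< 1+w<b
      x = τ ⟨$⟩ˡ y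

      shifted-high : ∀ i → IsHigh (place E i) → IsHigh (at i)
      shifted-high i h = lowShift-high zero (at i) (subst IsHigh (place≡ i) h)

      lowShift-stays-high : (u : Block (suc a) (suc m) (suc b)) → IsHigh u → IsHigh (lowShift zero u)
      lowShift-stays-high (high _) _ = tt

      val-place : ∀ i → val (collapseHigh x (place E i)) ≡ collapseHigh y (val (place E i))
      val-place i = trans (val-collapseHigh x _) (cong (λ z → collapseHigh z (val (place E i))) (inverseʳ τ))

      is-high : ∀ i → first p ≤ toℕ (tail p ⟨$⟩ʳ i) → IsHigh (at i)
      is-high i le with isHigh? (at i)
      ... | yes h = h
      ... | no ¬h = contradiction le (<⇒≱ (proj₁ (cut i) (proj₁ (f i) ¬h)))

      last-position : ∀ {i} → IsHigh (place E i) → toℕ i ≡ first p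
      last-position {i} h = ≤-antisym (s≤s⁻¹ (subst (toℕ i <ⁿ_) (sym 1+first≡k) (toℕ<n i)))
        (≮⇒≥ λ lt → proj₂ (f i) lt (shifted-high i h))

      unique : ∀ {i j} → IsHigh (place E i) → IsHigh (place E j) → i ≡ j
      unique h h′ = toℕ-injective (trans (last-position h) (sym (last-position h′)))

    -- If p misses σ or the middle block, `one-high` embeds p into π. If it meets both, the end of
    -- the low entries is a nonzero cut of the tail strictly under p₁, so deleting p₁ gains a
    -- component.
    ends-with-largest : CutAt (tail p) (first p) →
      (∀ i → (¬ IsHigh (at i) → toℕ i <ⁿ first p) × (toℕ i <ⁿ first p → ¬ IsHigh (at i))) →
      suc (first p) ≡ k → first π ≢ n → Case₁Conclusion p π
    ends-with-largest cut f 1+first≡k first≢n = by-cases (any? (isLow? ∘ at)) (any? (isMid? ∘ at))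
      where
      by-cases : Dec (∃ λ i → IsLow (at i)) → Dec (∃ λ i → IsMid (at i)) → Case₁Conclusion p π
      by-cases (no ¬l) _ = contradiction
        (one-high cut f 1+first≡k first≢n (embed-¬low rest zero ¬l) (λ _ → refl)) p⋠π
      by-cases (yes _) (no ¬m) = contradiction
        (one-high cut f 1+first≡k first≢n (embed-¬mid rest zero ¬m) (λ _ → refl)) p⋠π
      by-cases (yes (i , l)) (yes (j , mi)) =
        let d , _ , cut′ , g = low-cut rest
        in condition-b (comp-tail p (≤-<-trans z≤n (proj₁ (g i) l))
             (≤-<-trans (≮⇒≥ (mid⇒¬low (at j) mi ∘ proj₂ (g j))) (proj₁ (f j) (mid⇒¬high (at j) mi))) cut′)

    below-largest : first p <ⁿ k → ¬ comp p ≥ 3 → (∃ λ i → ¬ IsHigh (at i)) → CutAt (tail p) (first p) →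
      (∀ i → (¬ IsHigh (at i) → toℕ i <ⁿ first p) × (toℕ i <ⁿ first p → ¬ IsHigh (at i))) →
      Case₁Conclusion p π
    below-largest first<k ≱3 (i₀ , ¬h₀) cut f = by-cases (toℕ (p ⟨$⟩ʳ fromℕ k) <? k) (first π ≟ n)
      where
      cut-p : CutAt p (suc (first p))
      cut-p = cutAt-suc p ≤-refl cut

      c : toℕ (p ⟨$⟩ʳ fromℕ k) <ⁿ k ⊎ first π ≡ n → Case₁Conclusion p π
      c = condition-c (≤-<-trans z≤n (proj₁ (f i₀) ¬h₀))
        (≤-antisym (s≤s⁻¹ (≰⇒> ≱3)) (cut⇒comp≥2 {π = p} (s≤s z≤n) (s≤s first<k) cut-p))
        (firstComponentBeginsWithLargest {π = p} cut-p)

      -- If p ends with its largest entry, then k is a cut too. With fewer than three components it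
      -- must coincide with the cut at `suc (first p)`.
      1+first≡k : ¬ toℕ (p ⟨$⟩ʳ fromℕ k) <ⁿ k → suc (first p) ≡ k
      1+first≡k last≮k = ≤-antisym first<k (≮⇒≥ λ lt → ≱3 (cuts⇒comp≥3 {π = p} (s≤s z≤n) lt (n<1+n k) cut-p
        (cutAt-last {p = p} (≤-antisym (toℕ≤pred[n] _) (≮⇒≥ last≮k)))))

      by-cases : Dec (toℕ (p ⟨$⟩ʳ fromℕ k) <ⁿ k) → Dec (first π ≡ n) → Case₁Conclusion p π
      by-cases (yes last<k) _             = c (inj₁ last<k)
      by-cases (no _)       (yes first≡n) = c (inj₂ first≡n)
      by-cases (no last≮k)  (no first≢n)  = ends-with-largest cut f (1+first≡k last≮k) first≢n

    cut-at-first : Dec (first p ≡ k) → comp p ≥ 3 ⊎ ¬ comp p ≥ 3 →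
      (∃ λ i → ¬ IsHigh (at i)) → CutAt (tail p) (first p) →
      (∀ i → (¬ IsHigh (at i) → toℕ i <ⁿ first p) × (toℕ i <ⁿ first p → ¬ IsHigh (at i))) →
      Case₁Conclusion p π
    cut-at-first (yes first≡k) _ _ _ f = contradiction
      (no-high-greatest first≡k λ i → proj₂ (f i) (subst (toℕ i <ⁿ_) (sym first≡k) (toℕ<n i))) p⋠π
    cut-at-first (no _) (inj₁ ≥3) _ _ _ = condition-a ≥3
    cut-at-first (no first≢k) (inj₂ ≱3) = below-largest (≤∧≢⇒< (toℕ≤pred[n] (p ⟨$⟩ʳ zero)) first≢k) ≱3

    some-not-high : (∃ λ i → ¬ IsHigh (at i)) → Case₁Conclusion p π
    some-not-high ¬h@(i₀ , ¬h₀) = let _ , c≤k , cut , f = ¬high-cut rest in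
      by-cases cut f (m≤n⇒m<n∨m≡n (first≤cut c≤k cut (λ i → proj₂ (f i))))
      where
      by-cases : ∀ {c} → CutAt (tail p) c →
        (∀ i → (¬ IsHigh (at i) → toℕ i <ⁿ c) × (toℕ i <ⁿ c → ¬ IsHigh (at i))) →
        c <ⁿ first p ⊎ c ≡ first p → Case₁Conclusion p π
      by-cases cut f (inj₁ c<first) = condition-b (comp-tail p (≤-<-trans z≤n (proj₁ (f i₀) ¬h₀)) c<first cut)
      by-cases cut f (inj₂ refl)    = cut-at-first (first p ≟ k) (toSum (comp p ≥? 3)) ¬h cut f

    top-used : τ Avoids pattern-213 → Case₁Conclusion p π
    top-used avoids with any? (¬? ∘ isHigh? ∘ at)
    ... | yes ¬h = some-not-high ¬h
    ... | no ¬∃  = all-high avoids λ i → decidable-stable (isHigh? (at i)) (¬∃ ∘ (i ,_))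

f̃-comp≥3 : ∀ {k n} {p : Permutation′ k} {π : Permutation′ n} {ρ : Permutation′ (suc n)} →
           f̃[ π ]≡ ρ → π Avoids p → p ≼ ρ → comp p ≥ 3
f̃-comp≥3 {p = p} {π} {ρ} (a , m , b , σ , τ , _ , _ , _ , _ , π≅ , ρ≅) p⋠π em =
  [ (λ E → contradiction (embedding⇒≼ (model {π = π} {m} π≅) {p = p} E) p⋠π) , id ]′
    -- The two zeros are slots of the nonempty σ and τ, available to receive a displaced middle
    -- entry.
    (shrink zero zero (≼⇒embedding (model {π = ρ} {suc m} ρ≅) {p = p} em))
  where open Sum σ τ

case₁-conclusion : ∀ {k n} {p : Permutation′ (suc k)} {π : Permutation′ (suc n)} {ρ : Permutation′ (suc (suc n))} →
  Indecomposable π → first ρ ≡ first π → f̃[ tail π ]≡ tail ρ → π Avoids p → p ≼ ρ → Case₁Conclusion p π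
case₁-conclusion {k} {n} {p} {π} {ρ} ind firsts≡ f̃@(a , m , b , σ , τ , _ , _ , _ , τ-avoids , π≅ , ρ≅) p⋠π em@(ι , mono , _) =
  by-cases (ι zero ≟ᶠ zero)
  where
  open Sum σ τ
  open FirstEntry σ τ

  M : Model (tail π) m
  M = model {π = tail π} {m} π≅

  -- If π₁ did not exceed the cut of the tail in front of τ, restoring it would extend this to a
  -- proper cut of the indecomposable π.
  a+m<first : suc a + m <ⁿ first π
  a+m<first = ≰⇒> λ le → ind (cut⇒decomposable {π = π} (s≤s z≤n)
    (s≤s (subst (suc a + m <ⁿ_) (sym (Model.length≡ M)) (+-monoʳ-< (suc a) (m<m+n m (s≤s z≤n)))))
    (cutAt-suc π le (Model.middle-cut M)))

  w : ℕ
  w = proj₁ (m≤n⇒∃[o]m+o≡n a+m<first)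

  first-π : first π ≡ suc a + (m + suc w)
  first-π = trans (sym (proj₂ (m≤n⇒∃[o]m+o≡n a+m<first)))
    (trans (sym (+-suc (suc a + m) w)) (+-assoc (suc a) m (suc w)))

  first-ρ : first ρ ≡ suc a + (suc m + w)
  first-ρ = trans firsts≡ (trans first-π (cong (suc a +_) (+-suc m w)))

  by-cases : Dec (ι zero ≡ zero) → Case₁Conclusion p π
  by-cases (yes ι₀≡0) = top-used {p = p} {π} M first-π
    (≼⇒topEmbedding {p = p} {ρ} (model {π = tail ρ} {suc m} ρ≅) first-ρ em ι₀≡0) p⋠π τ-avoids
  -- Without ρ₁ the occurrence lies in the tail of ρ, and the result for f̃ applies to the tails of
  -- π and ρ.
  by-cases (no ι₀≢0) = condition-a (f̃-comp≥3 {p = p} {tail π} {tail ρ} f̃ (p⋠π ∘ tail-≼ {p = p} {π})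
    (mk≼ {p = p} {tail ρ} (proj₁ ∘ positive)
      (λ {i} {j} lt → s≤s⁻¹ (subst₂ _<_ (proj₂ (positive i)) (proj₂ (positive j)) (mono lt)))
      (λ {i} {j} lt → tail-cancel ρ (subst₂ (λ x y → ρ ⟨$⟩ʳ x < ρ ⟨$⟩ʳ y) (proj₂ (positive i)) (proj₂ (positive j))
        (≼-order {p = p} {ρ} em lt)))))
    where
    nonzero⇒suc : ∀ {n} (x : Fin (suc n)) → x ≢ zero → ∃ λ y → x ≡ suc y
    nonzero⇒suc zero    x≢0 = contradiction refl x≢0
    nonzero⇒suc (suc y) _   = y , refl

    positive : ∀ i → ∃ λ y → ι i ≡ suc y
    positive zero    = nonzero⇒suc (ι zero) ι₀≢0
    positive (suc i) = nonzero⇒suc (ι (suc i)) λ e → contradiction (subst (ι zero <_) e (mono {zero} {suc i} (s≤s z≤n))) λ ()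

-- Symmetries

Conclusion : ∀ {n} → Symmetry → Permutation′ (suc n) → Set
Conclusion {n} s q =
    (comp q ≥ 3)
  ⊎ (comp (q ∖ (q ⟨$⟩ʳ zero)) >ⁿ comp q)
  ⊎ ((zero {n} < q ⟨$⟩ʳ zero)
      × (comp q ≡ 2)
      × FirstComponentBeginsWithLargest q
      × (s ≡ revcomp ⊎ s ≡ revcomp-inverse → q ⟨$⟩ʳ fromℕ n < fromℕ n))
  ⊎ ((zero {n} < q ⟨$⟩ʳ zero)
      × (q ⟨$⟩ʳ zero < fromℕ n)
      × (q ∖ (q ⟨$⟩ʳ zero)) Avoids pattern-213)

-- For the reversed symmetries the hypothesis on `first π` discards the alternative left open in
-- `condition-c`.
conclude : ∀ {k n} s {q : Permutation′ (suc k)} {π : Permutation′ (suc n)} →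
           (s ≡ revcomp ⊎ s ≡ revcomp-inverse → first π ≢ n) → Case₁Conclusion q π → Conclusion s q
conclude s _ (condition-a ≥3) = inj₁ ≥3
conclude s {q} _ (condition-b lt) = inj₂ (inj₁ (subst (λ r → comp r >ⁿ comp q) (sym (∖-first q)) lt))
conclude {k} s {q} first≢n (condition-c 0< comp≡2 largest last) =
  inj₂ (inj₂ (inj₁ (0< , comp≡2 , largest , λ reversed →
    subst (toℕ (q ⟨$⟩ʳ fromℕ k) <ⁿ_) (sym (toℕ-fromℕ k)) ([ id , (λ e → contradiction e (first≢n reversed)) ]′ last))))
conclude {k} s {q} _ (condition-d 0< <k avoids) =
  inj₂ (inj₂ (inj₂ (0< , subst (first q <ⁿ_) (sym (toℕ-fromℕ k)) <k ,
    subst (_Avoids pattern-213) (sym (∖-first q)) avoids)))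

remove-rc-decomposable : ∀ {n} {π : Permutation′ (suc n)} i →
  Decomposable (remove i (rc π)) → Decomposable (remove (opposite i) π)
remove-rc-decomposable {π = π} i d =
  decomposable-resp-≈ {π = rc (rc ρ)} {ρ} (rc-involutive ρ)
    (decomposable-rc {π = rc ρ} (decomposable-resp-≈ {π = remove i (rc π)} {rc ρ} (sym ∘ rc-remove π i) d))
  where
  ρ = remove (opposite i) π

-- Deleting the least value of π deletes the first entry of its inverse. This makes `case₃`
-- impossible directly under `case₂`.
inverse-∖-decomposable : ∀ {n} {π : Permutation′ (suc n)} →
  Decomposable (π ∖ zero) → Decomposable (flip π ∖ (flip π ⟨$⟩ʳ zero))
inverse-∖-decomposable {π = π} d = decomposable-resp-≈ {π = flip (π ∖ zero)} {flip π ∖ (flip π ⟨$⟩ʳ zero)}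
  (flip-remove π (π ⟨$⟩ˡ zero)) (decomposable-flip {π = π ∖ zero} d)

-- If the reverse-complement begins with its largest entry, then π ends with its least, so both
-- deletions concern the same entry of π.
rc-first-largest : ∀ {n} {π : Permutation′ (suc n)} → first (rc π) ≡ n →
  Decomposable (rc π ∖ (rc π ⟨$⟩ʳ zero)) → Decomposable (π ∖ zero)
rc-first-largest {n} {π} first≡n d = subst (λ i → Decomposable (remove i π)) last≡π⁻¹0
  (remove-rc-decomposable {π = π} zero (subst Decomposable (∖-first (rc π)) d))
  where
  π-last : π ⟨$⟩ʳ fromℕ n ≡ zero
  π-last = trans (sym (opposite-involutive _)) (trans
    (cong opposite (toℕ-injective (trans first≡n (sym (toℕ-fromℕ n))))) (opposite-involutive zero))

  last≡π⁻¹0 : fromℕ n ≡ π ⟨$⟩ˡ zero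
  last≡π⁻¹0 = trans (sym (inverseˡ π)) (cong (π ⟨$⟩ˡ_) π-last)

-- Here the least value of `rc π` is in last position, so π begins with its largest entry, and again
-- both deletions concern the same entry.
rc-inverse-first-largest : ∀ {n} {π : Permutation′ (suc n)} → first (flip (rc π)) ≡ n →
  Decomposable (rc π ∖ zero) → Decomposable (π ∖ (π ⟨$⟩ʳ zero))
rc-inverse-first-largest {n} {π} first≡n d = subst Decomposable (sym (∖-first π))
  (subst (λ i → Decomposable (remove i π)) opposite≡0 (remove-rc-decomposable {π = π} (rc π ⟨$⟩ˡ zero) d))
  where
  opposite≡0 : opposite (rc π ⟨$⟩ˡ zero) ≡ zero
  opposite≡0 = trans (cong opposite (toℕ-injective (trans first≡n (sym (toℕ-fromℕ n))))) (opposite-involutive zero)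

not-reversed : ∀ {X : Set} {s} → s ≢ revcomp → s ≢ revcomp-inverse → s ≡ revcomp ⊎ s ≡ revcomp-inverse → X
not-reversed ≢rc _ (inj₁ e) = contradiction e ≢rc
not-reversed _ ≢rci (inj₂ e) = contradiction e ≢rci

∖-first-f̃ : ∀ {n} {π : Permutation′ (suc n)} {ρ : Permutation′ (suc (suc n))} →
  f̃[ π ∖ (π ⟨$⟩ʳ zero) ]≡ (ρ ∖ (ρ ⟨$⟩ʳ zero)) → f̃[ tail π ]≡ tail ρ
∖-first-f̃ {π = π} {ρ} = subst₂ f̃[_]≡_ (∖-first π) (∖-first ρ)

module _ {k} (p : Permutation′ (suc k)) where

  mutual

    new-pattern : ∀ {n} {π : Permutation′ n} {ρ} → f[ π ]≡ ρ → π Avoids p → p ≼ ρ →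
                  ∃ λ s → Conclusion s (image s p)
    new-pattern {π = π} {ρ} (decomposable f̃) avoids em =
      self , inj₁ (f̃-comp≥3 {p = p} {π} {ρ} f̃ avoids em)
    new-pattern {π = π} {ρ} (case₁ (ind , _) _ first≡ f̃) avoids em =
      self , conclude self {p} {π} (not-reversed (λ ()) (λ ()))
        (case₁-conclusion {p = p} {π} {ρ} ind first≡ (∖-first-f̃ {π = π} {ρ} f̃) avoids em)
    new-pattern {π = π} {ρ} (case₂ _ _ (decomposable f̃)) avoids em =
      inverse , inj₁ (f̃-comp≥3 {p = flip p} {flip π} {flip ρ} f̃
        (avoids ∘ flip-≼ {p = flip p} {flip π}) (flip-≼ {p = p} {ρ} em))
    new-pattern {π = π} {ρ} (case₂ _ _ (case₁ (ind , _) _ first≡ f̃)) avoids em =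
      inverse , conclude inverse {flip p} {flip π} (not-reversed (λ ()) (λ ()))
        (case₁-conclusion {p = flip p} {flip π} {flip ρ} ind first≡ (∖-first-f̃ {π = flip π} {flip ρ} f̃)
          (avoids ∘ flip-≼ {p = flip p} {flip π}) (flip-≼ {p = p} {ρ} em))
    -- For containment two inversions cancel definitionally, so `avoids` and `em` carry over
    -- unchanged to the smaller derivation.
    new-pattern (case₂ _ _ (case₂ _ _ d)) avoids em = new-pattern d avoids em
    new-pattern {π = π} (case₂ _ dec (case₃ _ ind _ _)) avoids em =
      contradiction (inverse-∖-decomposable {π = π} dec) ind
    new-pattern {π = π} {ρ} (case₃ _ ind ind′ d) avoids em = new-pattern-rc {π = π} {ρ} ind ind′ d avoids em

    -- Treated apart from `new-pattern` so that the two indecomposable deletions given by `case₃`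
    -- remain at hand through further inversions; they exclude a first entry that is largest.
    new-pattern-rc : ∀ {n} {π : Permutation′ (suc n)} {ρ : Permutation′ (suc (suc n))} →
      Indecomposable (π ∖ (π ⟨$⟩ʳ zero)) → Indecomposable (π ∖ zero) →
      f[ rc π ]≡ rc ρ → π Avoids p → p ≼ ρ → ∃ λ s → Conclusion s (image s p)
    new-pattern-rc {π = π} {ρ} _ _ (decomposable f̃) avoids em =
      revcomp , inj₁ (f̃-comp≥3 {p = rc p} {rc π} {rc ρ} f̃
        (avoids ∘ rc-≼⁻¹ {p = p} {π}) (rc-≼ {p = p} {ρ} em))
    new-pattern-rc {π = π} {ρ} _ ind′ (case₁ (ind , _) dec first≡ f̃) avoids em =
      revcomp , conclude revcomp {rc p} {rc π} (λ _ first≡n → ind′ (rc-first-largest {π = π} first≡n dec))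
        (case₁-conclusion {p = rc p} {rc π} {rc ρ} ind first≡ (∖-first-f̃ {π = rc π} {rc ρ} f̃)
          (avoids ∘ rc-≼⁻¹ {p = p} {π}) (rc-≼ {p = p} {ρ} em))
    new-pattern-rc {π = π} {ρ} _ _ (case₂ _ _ (decomposable f̃)) avoids em =
      revcomp-inverse , inj₁ (f̃-comp≥3 {p = flip (rc p)} {flip (rc π)} {flip (rc ρ)} f̃
        (avoids ∘ rc-≼⁻¹ {p = p} {π} ∘ flip-≼ {p = flip (rc p)} {flip (rc π)})
        (flip-≼ {p = rc p} {rc ρ} (rc-≼ {p = p} {ρ} em)))
    new-pattern-rc {π = π} {ρ} ind₁ _ (case₂ _ dec (case₁ (ind , _) _ first≡ f̃)) avoids em =
      revcomp-inverse , conclude revcomp-inverse {flip (rc p)} {flip (rc π)}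
        (λ _ first≡n → ind₁ (rc-inverse-first-largest {π = π} first≡n dec))
        (case₁-conclusion {p = flip (rc p)} {flip (rc π)} {flip (rc ρ)} ind first≡
          (∖-first-f̃ {π = flip (rc π)} {flip (rc ρ)} f̃)
          (avoids ∘ rc-≼⁻¹ {p = p} {π} ∘ flip-≼ {p = flip (rc p)} {flip (rc π)})
          (flip-≼ {p = rc p} {rc ρ} (rc-≼ {p = p} {ρ} em)))
    new-pattern-rc {π = π} {ρ} ind ind′ (case₂ _ _ (case₂ _ _ d)) avoids em =
      new-pattern-rc {π = π} {ρ} ind ind′ d avoids em
    new-pattern-rc {π = π} _ _ (case₂ _ dec (case₃ _ ind _ _)) avoids em =
      contradiction (inverse-∖-decomposable {π = rc π} dec) ind
    -- Two reverse-complements cancel only pointwise, so both containments are transported along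
    -- `rc-involutive`.
    new-pattern-rc {π = π} {ρ} _ _ (case₃ _ _ _ d) avoids em = new-pattern d
      (avoids ∘ ≼-resp-≈ {p = p} {p} {rc (rc π)} {π} (λ _ → refl) (rc-involutive π))
      (≼-resp-≈ {p = p} {p} {ρ} {rc (rc ρ)} (λ _ → refl) (sym ∘ rc-involutive ρ) em)

-- Decidability of the conclusion

reversed? : ∀ s → Dec (s ≡ revcomp ⊎ s ≡ revcomp-inverse)
reversed? self            = no λ { (inj₁ ()) ; (inj₂ ()) }
reversed? inverse         = no λ { (inj₁ ()) ; (inj₂ ()) }
reversed? revcomp         = yes (inj₁ refl)
reversed? revcomp-inverse = yes (inj₂ refl)

firstBeginsWithLargest? : ∀ cs → Dec (FirstBeginsWithLargest cs)
firstBeginsWithLargest? []                      = no λ ()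
firstBeginsWithLargest? (component {s} σ _ ∷ _) = σ ⟨$⟩ʳ zero ≟ᶠ fromℕ s

conclusion? : ∀ {n} s (q : Permutation′ (suc n)) → Dec (Conclusion s q)
conclusion? {n} s q =
        (comp q ≥? 3)
  ⊎-dec (comp (q ∖ (q ⟨$⟩ʳ zero)) >? comp q)
  ⊎-dec ((0 <? first q) ×-dec (comp q ≟ 2) ×-dec firstBeginsWithLargest? (components q)
           ×-dec (reversed? s →-dec (toℕ (q ⟨$⟩ʳ fromℕ n) <? toℕ (fromℕ n))))
  ⊎-dec ((0 <? first q) ×-dec (first q <? toℕ (fromℕ n)) ×-dec avoids213? (q ∖ (q ⟨$⟩ʳ zero)))

anySymmetry? : ∀ {P : Symmetry → Set} → (∀ s → Dec (P s)) → Dec (∃ P)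
anySymmetry? P? = map′
  (λ { (inj₁ x) → _ , x ; (inj₂ (inj₁ x)) → _ , x ; (inj₂ (inj₂ (inj₁ x))) → _ , x ; (inj₂ (inj₂ (inj₂ x))) → _ , x })
  (λ { (self , x) → inj₁ x ; (inverse , x) → inj₂ (inj₁ x) ; (revcomp , x) → inj₂ (inj₂ (inj₁ x))
     ; (revcomp-inverse , x) → inj₂ (inj₂ (inj₂ x)) })
  (P? self ⊎-dec P? inverse ⊎-dec P? revcomp ⊎-dec P? revcomp-inverse)

theorem6p6 : ∀ {n} (p : Permutation′ (suc n)) →
    p Avoids pattern-1324 →
    f-Incompatible p →
    ∃ λ (s : Symmetry) → let q = image s p in
    (comp q ≥ 3)
    ⊎ (comp (q ∖ (q ⟨$⟩ʳ zero)) >ⁿ comp q)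
    ⊎ ((zero {n} < q ⟨$⟩ʳ zero)
    × (comp q ≡ 2)
    × FirstComponentBeginsWithLargest q
    × (s ≡ revcomp ⊎ s ≡ revcomp-inverse → q ⟨$⟩ʳ fromℕ n < fromℕ n))
    ⊎ ((zero {n} < q ⟨$⟩ʳ zero)
    × (q ⟨$⟩ʳ zero < fromℕ n)
    × (q ∖ (q ⟨$⟩ʳ zero)) Avoids pattern-213)
-- Incompatibility is the negation of a universal statement and yields no explicit counterexample.
-- The conclusion is therefore reached under a double negation, which decidability removes.
theorem6p6 p _ incompatible = decidable-stable (anySymmetry? λ s → conclusion? s (image s p))
  λ ¬conclusion → incompatible λ _ _ _ avoids _ d em → ¬conclusion (new-pattern p d avoids em)
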